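{- For all integers $n\geq 0$, $$a_{1^{ -1}2^{2}4^{ -2}5^{1}}(4n)>0,\qquad a_{1^{ -1}2^{2}4^{ -2}5^{1}}(2n+1)>0,\qquad a_{1^{ -1}2^{2}4^{ -2}5^{1}}(4n+2)=0.$$
   Context: For $|q|<1$ (or as formal power series in $q$) let $f_j:=(q^j;q^j)_\infty=\prod_{k\ge 1}(1-q^{jk})$ for each positive integer $j$. The integers $a_{1^{ -1}2^{2}4^{ -2}5^{1}}(n)$, $n\ge 0$, are defined by $\sum_{n=0}^\infty a_{1^{ -1}2^{2}4^{ -2}5^{1}}(n)q^n=\dfrac{f_2^2f_5}{f_1f_4^2}$. -}

module Defs where

open import Data.Bool.Base using (if_then_else_)
open import Data.Fin.Base using (Fin; toℕ)
open import Data.Fin.Properties using (toℕ<n)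
open import Data.Integer.Base using (ℤ; 0ℤ; 1ℤ; _+_; _*_; _-_)
import Data.Integer.Properties as ℤ
open import Data.Integer.Tactic.RingSolver using (solve-∀)
open import Data.Nat.Base as ℕ using (ℕ; zero; suc; _∸_; NonZero; _≤_; _<_; s≤s; z≤n)
import Data.Nat.Properties as ℕ
open import Relation.Binary.PropositionalEquality
open import Relation.Nullary using (does)
open import Relation.Nullary.Decidable using (dec-false)

open import Algebra.Properties.Semiring.Sum ℤ.+-*-semiring
  using (sum; sum⁺-syntax; sum-cong-≗; sum-replicate-zero)

-- Formal power series over ℤ in q, given by their coefficient sequences;
-- two series are equal when they are equal pointwise (_≗_).

Series : Set
Series = ℕ → ℤ

infixl 6 _⊖_
infixl 7 _·_ _÷_
infixr 8 _^_ q^_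

q^_ : ℕ → Series
(q^ m) n = if does (n ℕ.≟ m) then 1ℤ else 0ℤ

𝟙 : Series
𝟙 = q^ 0

_⊖_ : Series → Series → Series
(u ⊖ v) n = u n - v n

_·_ : Series → Series → Series
(u · v) n = ∑[ k ≤ n ] (u (toℕ k) * v (n ∸ toℕ k))

_^_ : Series → ℕ → Series
u ^ zero  = 𝟙
u ^ suc m = u · u ^ m

-- Long division.  Writing u = u₀ + q u′ and g = 1 + q g′,
--   u / g = u₀ + q ((u′ - u₀ g′) / g).
-- This is the quotient only for divisors with constant term 1; see ÷-correct.

_÷_ : Series → Series → Series
(u ÷ g) zero    = u 0
(u ÷ g) (suc n) = ((λ k → u (suc k) - u 0 * g (suc k)) ÷ g) n

÷-correct : ∀ u g → g 0 ≡ 1ℤ → (u ÷ g) · g ≗ u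
÷-correct u g g₀≡1 zero = begin
  u 0 * g 0 + 0ℤ  ≡⟨ ℤ.+-identityʳ _ ⟩
  u 0 * g 0       ≡⟨ cong (u 0 *_) g₀≡1 ⟩
  u 0 * 1ℤ        ≡⟨ ℤ.*-identityʳ (u 0) ⟩
  u 0             ∎
  where open ≡-Reasoning
÷-correct u g g₀≡1 (suc n) =
  trans (cong (u 0 * g (suc n) +_) (÷-correct remainder g g₀≡1 n))
        (cancel (u 0 * g (suc n)) (u (suc n)))
  where
  remainder : Series
  remainder k = u (suc k) - u 0 * g (suc k)

  cancel : ∀ x y → x + (y - x) ≡ y
  cancel = solve-∀

-- ∏_{k=1}^{N} (1 - q^{jk})

partialProduct : ℕ → ℕ → Series
partialProduct j zero    = 𝟙
partialProduct j (suc N) = (𝟙 ⊖ q^ (j ℕ.* suc N)) · partialProduct j N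

-- f j = ∏_{k≥1} (1 - q^{jk}).  The factors with k > n do not affect the
-- coefficient of qⁿ, so it can be read off the n-th partial product; see
-- partialProduct-stable.

f : (j : ℕ) → .{{_ : NonZero j}} → Series
f j n = partialProduct j n n

q^-≢ : ∀ m n → n ≢ m → (q^ m) n ≡ 0ℤ
q^-≢ m n n≢m = cong (if_then 1ℤ else 0ℤ) (dec-false (n ℕ.≟ m) n≢m)

factor-stable : ∀ m n (p : Series) → n < m → ((𝟙 ⊖ q^ m) · p) n ≡ p n
factor-stable m n p n<m = begin
  (1ℤ - (q^ m) 0) * p n + sum tail  ≡⟨ cong₂ (λ x y → (1ℤ - x) * p n + y) (q^-≢ m 0 0≢m) tail≡0 ⟩
  1ℤ * p n + 0ℤ                     ≡⟨ ℤ.+-identityʳ _ ⟩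
  1ℤ * p n                          ≡⟨ ℤ.*-identityˡ (p n) ⟩
  p n                               ∎
  where
  open ≡-Reasoning

  tail : Fin n → ℤ
  tail k = (0ℤ - (q^ m) (suc (toℕ k))) * p (n ∸ suc (toℕ k))

  0≢m : 0 ≢ m
  0≢m = ℕ.<⇒≢ (ℕ.≤-<-trans z≤n n<m)

  tail≡0 : sum tail ≡ 0ℤ
  tail≡0 = trans
    (sum-cong-≗ λ k → cong (λ x → (0ℤ - x) * p (n ∸ suc (toℕ k)))
      (q^-≢ m (suc (toℕ k)) (ℕ.<⇒≢ (ℕ.≤-<-trans (toℕ<n k) n<m))))
    (sum-replicate-zero n)

partialProduct-stable : ∀ j .{{_ : NonZero j}} {n N} → n ≤ N → partialProduct j N n ≡ f j n
partialProduct-stable j n≤N = go (ℕ.≤⇒≤′ n≤N)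
  where
  go : ∀ {n N} → n ℕ.≤′ N → partialProduct j N n ≡ f j n
  go ℕ.≤′-refl = refl
  go {n} {suc N} (ℕ.≤′-step n≤′N) = trans
    (factor-stable (j ℕ.* suc N) n (partialProduct j N)
      (ℕ.<-≤-trans (s≤s (ℕ.≤′⇒≤ n≤′N)) (ℕ.m≤n*m (suc N) j)))
    (go n≤′N)

-- The coefficients of f₂² f₅ / (f₁ f₄²).

a : ℕ → ℤ
a = (f 2 ^ 2 · f 5) ÷ (f 1 · f 4 ^ 2)

a-defining : a · (f 1 · f 4 ^ 2) ≗ f 2 ^ 2 · f 5
a-defining = ÷-correct (f 2 ^ 2 · f 5) (f 1 · f 4 ^ 2) refl

{-# OPTIONS --safe #-}

-- Write (a; b) for the theta product ∏_{k≥1} (1 + q^{ck-a})(1 + q^{ck-b})(1 - q^{ck})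
-- with c = a + b, which is Σ_{j∈ℤ} q^{cj(j-1)/2 + aj} by Jacobi's triple product.
-- Repeated use of (1 - x)(1 + x) = 1 - x² turns the quotient into
--   f₂² f₅ / (f₁ f₄²) = (9; 1)(7; 3) / (f₄ f₂₀).
-- In the double sum over (m, n) the numerator has exponent 5m² + 4m + 5n² + 2n.
-- Splitting by the parity of m + n and rotating the lattice gives
--   (9; 1)(7; 3) = (16; 4)(12; 8) + q (6; 14)(2; 18).
-- Divided by f₄ f₂₀, the first summand is a series in q⁴ and the second is q times a
-- series in q², and both are products of factors 1 + q^e and 1 / (1 - q^e), so their
-- coefficients are nonnegative; the factor 1 / (1 - q⁴) in each, together with 1 + q²
-- in the second, makes every coefficient positive that is not forced to vanish.

module Submission where

open import Defs
open import Algebra.Bundles using (CommutativeMonoid; CommutativeRing)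
import Algebra.Properties.CommutativeSemigroup
import Algebra.Properties.Ring
open import Algebra.Structures using (IsCommutativeRing)
open import Data.Bool.Base using (if_then_else_; true; false)
open import Data.Integer.Base as ℤ using (ℤ; 0ℤ; 1ℤ; _+_; _*_; -_; _-_; +_; -[1+_]; _≤_; _<_; +≤+; +<+)
open import Data.Integer.DivMod using (_/ℕ_; _%ℕ_; a≡a%ℕn+[a/ℕn]*n; n%ℕd<d)
import Data.Integer.Properties as ℤ
import Data.Integer.Tactic.RingSolver as ℤSolver
open import Data.List.Base using (List; []; _∷_; applyUpTo; _++_; map; filter; cartesianProduct)
open import Data.List.Membership.Propositional using (_∈_)
open import Data.List.Membership.Propositional.Properties
  using (∈-applyUpTo⁺; ∈-map⁺; ∈-map⁻; ∈-++⁺ˡ; ∈-++⁺ʳ; ∈-filter⁺; ∈-filter⁻; ∈-cartesianProduct⁺)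
open import Data.List.Membership.Propositional.Properties.WithK using (unique∧set⇒bag)
open import Data.List.Properties using (filter-accept; filter-reject)
open import Data.List.Relation.Binary.BagAndSetEquality using (∼bag⇒↭)
open import Data.List.Relation.Binary.Permutation.Propositional as Perm using (_↭_)
open import Data.List.Relation.Unary.Unique.Propositional using (Unique)
import Data.List.Relation.Unary.Unique.Propositional.Properties as Unique
open import Data.Nat.Base as ℕ using (ℕ; zero; suc; s≤s; z≤n; NonZero)
open import Data.Nat.Divisibility
  using (_∣_; _∤_; _∣?_; divides; ∣m+n∣m⇒∣n; ∣m∣n⇒∣m+n; ∣n⇒∣m*n; m∣m*n; ∣-refl; ∣-trans; _∣0; 1∣_; ∣⇒≤)
import Data.Nat.Properties as ℕ
import Data.Nat.Tactic.RingSolver as ℕSolver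
open import Data.Product.Base using (_×_; _,_; ∃)
open import Data.Sum.Base using (_⊎_; inj₁; inj₂)
open import Function.Base using (_∘_; _$_)
open import Function.Bundles using (mk⇔)
open import Relation.Binary.Bundles using (Setoid)
open import Relation.Binary.PropositionalEquality
import Relation.Binary.Reasoning.Setoid as SetoidReasoning
open import Relation.Nullary using (does; yes; no)
open import Relation.Nullary.Decidable using (dec-true; dec-false; from-no)

-- The obstacles are infinite sums and division. An identity between theta series is therefore
-- proved modulo `q^(N+1)` for every `N`, as an identity of finite sums over the indices from -N to
-- N. A quotient is cross-multiplied, and common factors are cancelled because their constant term
-- is 1. The pairs (9, 1) and (7, 3) arise by inclusion-exclusion: dividing (-q; q)_∞ (-q^10;
-- q^10)_∞ by (-q²; q²)_∞ (-q⁵; q⁵)_∞ leaves exactly the residues prime to 10. The rotation m = r +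
-- s - δ, n = r - s decouples the variables because both theta series have leading coefficient 5:
-- 5m² + 5n² has no cross term rs, so each parity class is again a product of two theta series.

module ℤ+ = Algebra.Properties.CommutativeSemigroup ℤ.+-commutativeSemigroup

-- The solver runs in an abstract monoid, since comparing products of concrete
-- series would unfold the convolution.
module Rearrange {c ℓ} (M : CommutativeMonoid c ℓ) where
  module M = CommutativeMonoid M
  open M using (_∙_; ε; _≈_; ∙-cong; ∙-congˡ; ∙-congʳ; identityʳ)
  open import Algebra.Solver.CommutativeMonoid M using (_⊜_; solve; id) renaming (_⊕_ to _⊗_)

  collect₁ : ∀ g a u b v → g ∙ ((a ∙ u) ∙ (b ∙ v)) ≈ a ∙ (g ∙ (u ∙ (b ∙ v)))
  collect₁ = solve 5 (λ g a u b v → (g ⊗ ((a ⊗ u) ⊗ (b ⊗ v))) ⊜ (a ⊗ (g ⊗ (u ⊗ (b ⊗ v))))) M.refl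

  collect₂ : ∀ x g a u b v → (x ∙ g) ∙ ((a ∙ u) ∙ (b ∙ v)) ≈ (x ∙ b) ∙ (g ∙ ((a ∙ u) ∙ v))
  collect₂ = solve 6 (λ x g a u b v → ((x ⊗ g) ⊗ ((a ⊗ u) ⊗ (b ⊗ v))) ⊜ ((x ⊗ b) ⊗ (g ⊗ ((a ⊗ u) ⊗ v)))) M.refl

  -- Each `pᵣ` stands for (-q^r; q^10)_∞. The classes 2, 4, 6, 8, 10 come from (-q²; q²)_∞, the
  -- classes 5 and 10 from (-q⁵; q⁵)_∞, and 1, 3, 7, 9 from the two triple products. Only class 10
  -- occurs twice, whence the extra `p₁₀`.
  odd-residues : ∀ p₁ p₂ p₃ p₄ p₅ p₆ p₇ p₈ p₉ p₁₀ f →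
    ((p₁₀ ∙ (p₈ ∙ (p₆ ∙ (p₄ ∙ (p₂ ∙ ε))))) ∙ (p₁₀ ∙ (p₅ ∙ ε))) ∙ (((p₉ ∙ p₁) ∙ f) ∙ ((p₇ ∙ p₃) ∙ f)) ≈
    ((p₁₀ ∙ (p₉ ∙ (p₈ ∙ (p₇ ∙ (p₆ ∙ (p₅ ∙ (p₄ ∙ (p₃ ∙ (p₂ ∙ (p₁ ∙ ε)))))))))) ∙ p₁₀) ∙ (f ∙ f)
  odd-residues = solve 11 (λ p₁ p₂ p₃ p₄ p₅ p₆ p₇ p₈ p₉ p₁₀ f →
    (((p₁₀ ⊗ (p₈ ⊗ (p₆ ⊗ (p₄ ⊗ (p₂ ⊗ id))))) ⊗ (p₁₀ ⊗ (p₅ ⊗ id))) ⊗ (((p₉ ⊗ p₁) ⊗ f) ⊗ ((p₇ ⊗ p₃) ⊗ f))) ⊜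
    (((p₁₀ ⊗ (p₉ ⊗ (p₈ ⊗ (p₇ ⊗ (p₆ ⊗ (p₅ ⊗ (p₄ ⊗ (p₃ ⊗ (p₂ ⊗ (p₁ ⊗ id)))))))))) ⊗ p₁₀) ⊗ (f ⊗ f))) M.refl

  -- The factor `p₂ ∙ p₅` is carried on both sides because it completes `f₂` to `f₄` and `f₅` to
  -- `f₁₀` without any division.
  eliminate-doubles : ∀ {f₁ f₂ f₄ f₅ f₁₀ f₂₀ p₁ p₂ p₅ p₁₀ θ} →
    f₂ ≈ f₁ ∙ p₁ → f₄ ≈ f₂ ∙ p₂ → f₁₀ ≈ f₅ ∙ p₅ → f₂₀ ≈ f₁₀ ∙ p₁₀ →
    (p₂ ∙ p₅) ∙ θ ≈ (p₁ ∙ p₁₀) ∙ (f₁₀ ∙ f₁₀) →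
    (p₂ ∙ p₅) ∙ (((f₂ ∙ f₂) ∙ f₅) ∙ f₂₀) ≈ (p₂ ∙ p₅) ∙ ((f₁ ∙ f₄) ∙ θ)
  eliminate-doubles {f₁} {f₂} {f₄} {f₅} {f₁₀} {f₂₀} {p₁} {p₂} {p₅} {p₁₀} {θ} 2=1 4=2 10=5 20=10 p = begin
    (p₂ ∙ p₅) ∙ (((f₂ ∙ f₂) ∙ f₅) ∙ f₂₀)
      ≈⟨ solve 5 (λ f₂ f₅ f₂₀ p₂ p₅ → ((p₂ ⊗ p₅) ⊗ (((f₂ ⊗ f₂) ⊗ f₅) ⊗ f₂₀)) ⊜
                                      (((f₂ ⊗ p₂) ⊗ (f₅ ⊗ p₅)) ⊗ (f₂ ⊗ f₂₀))) M.refl f₂ f₅ f₂₀ p₂ p₅ ⟩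
    ((f₂ ∙ p₂) ∙ (f₅ ∙ p₅)) ∙ (f₂ ∙ f₂₀)
      ≈⟨ ∙-cong (∙-cong (M.sym 4=2) (M.sym 10=5)) (∙-cong 2=1 20=10) ⟩
    (f₄ ∙ f₁₀) ∙ ((f₁ ∙ p₁) ∙ (f₁₀ ∙ p₁₀))
      ≈⟨ solve 5 (λ f₁ f₄ f₁₀ p₁ p₁₀ → ((f₄ ⊗ f₁₀) ⊗ ((f₁ ⊗ p₁) ⊗ (f₁₀ ⊗ p₁₀))) ⊜
                                       ((f₁ ⊗ f₄) ⊗ ((p₁ ⊗ p₁₀) ⊗ (f₁₀ ⊗ f₁₀)))) M.refl f₁ f₄ f₁₀ p₁ p₁₀ ⟩
    (f₁ ∙ f₄) ∙ ((p₁ ∙ p₁₀) ∙ (f₁₀ ∙ f₁₀))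
      ≈⟨ ∙-congˡ p ⟨
    (f₁ ∙ f₄) ∙ ((p₂ ∙ p₅) ∙ θ)
      ≈⟨ solve 4 (λ f₁ f₄ p θ → ((f₁ ⊗ f₄) ⊗ (p ⊗ θ)) ⊜ (p ⊗ ((f₁ ⊗ f₄) ⊗ θ))) M.refl f₁ f₄ (p₂ ∙ p₅) θ ⟩
    (p₂ ∙ p₅) ∙ ((f₁ ∙ f₄) ∙ θ) ∎
    where open SetoidReasoning M.setoid

  -- Meant for f₄ split into the classes 4, 8, 12, 16, 20 modulo 20: inverses of the first four
  -- leave f₂₀.
  cancel-geometric : ∀ {g₁ g₂ g₃ g₄ o₁ o₂ o₃ o₄} o₅ → g₁ ∙ o₁ ≈ ε → g₂ ∙ o₂ ≈ ε → g₃ ∙ o₃ ≈ ε → g₄ ∙ o₄ ≈ ε →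
    (g₁ ∙ (g₂ ∙ (g₃ ∙ g₄))) ∙ (o₅ ∙ (o₄ ∙ (o₃ ∙ (o₂ ∙ (o₁ ∙ ε))))) ≈ o₅
  cancel-geometric {g₁} {g₂} {g₃} {g₄} {o₁} {o₂} {o₃} {o₄} o₅ p₁ p₂ p₃ p₄ = begin
    (g₁ ∙ (g₂ ∙ (g₃ ∙ g₄))) ∙ (o₅ ∙ (o₄ ∙ (o₃ ∙ (o₂ ∙ (o₁ ∙ ε)))))
      ≈⟨ solve 9 (λ g₁ g₂ g₃ g₄ o₁ o₂ o₃ o₄ o₅ →
           ((g₁ ⊗ (g₂ ⊗ (g₃ ⊗ g₄))) ⊗ (o₅ ⊗ (o₄ ⊗ (o₃ ⊗ (o₂ ⊗ (o₁ ⊗ id)))))) ⊜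
           ((g₁ ⊗ o₁) ⊗ ((g₂ ⊗ o₂) ⊗ ((g₃ ⊗ o₃) ⊗ ((g₄ ⊗ o₄) ⊗ o₅))))) M.refl g₁ g₂ g₃ g₄ o₁ o₂ o₃ o₄ o₅ ⟩
    (g₁ ∙ o₁) ∙ ((g₂ ∙ o₂) ∙ ((g₃ ∙ o₃) ∙ ((g₄ ∙ o₄) ∙ o₅)))
      ≈⟨ ∙-cong p₁ (∙-cong p₂ (∙-cong p₃ (∙-congʳ p₄))) ⟩
    ε ∙ (ε ∙ (ε ∙ (ε ∙ o₅)))
      ≈⟨ solve 1 (λ o → (id ⊗ (id ⊗ (id ⊗ (id ⊗ o)))) ⊜ o) M.refl o₅ ⟩
    o₅ ∎
    where open SetoidReasoning M.setoid

  -- Trading `w ∙ f₄` for `f₂₀` yields the second of two copies of `f₂₀`, one for each triple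
  -- product.
  attach : ∀ {w f₄ f₂₀} u v → w ∙ f₄ ≈ f₂₀ → ((u ∙ v) ∙ w) ∙ (f₄ ∙ f₂₀) ≈ (u ∙ f₂₀) ∙ (v ∙ f₂₀)
  attach {w} {f₄} {f₂₀} u v p = begin
    ((u ∙ v) ∙ w) ∙ (f₄ ∙ f₂₀)
      ≈⟨ solve 5 (λ u v w f₄ f₂₀ → (((u ⊗ v) ⊗ w) ⊗ (f₄ ⊗ f₂₀)) ⊜ ((u ⊗ (w ⊗ f₄)) ⊗ (v ⊗ f₂₀))) M.refl u v w f₄ f₂₀ ⟩
    (u ∙ (w ∙ f₄)) ∙ (v ∙ f₂₀)
      ≈⟨ ∙-congʳ (∙-congˡ p) ⟩
    (u ∙ f₂₀) ∙ (v ∙ f₂₀) ∎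
    where open SetoidReasoning M.setoid

  quotient-cross : ∀ {a f₁ f₂ f₄ f₅} f₂₀ → a ∙ (f₁ ∙ (f₄ ∙ (f₄ ∙ ε))) ≈ (f₂ ∙ (f₂ ∙ ε)) ∙ f₅ →
                   ((f₁ ∙ f₄) ∙ (f₄ ∙ f₂₀)) ∙ a ≈ ((f₂ ∙ f₂) ∙ f₅) ∙ f₂₀
  quotient-cross {a} {f₁} {f₂} {f₄} {f₅} f₂₀ p = begin
    ((f₁ ∙ f₄) ∙ (f₄ ∙ f₂₀)) ∙ a
      ≈⟨ solve 4 (λ a f₁ f₄ f₂₀ → (((f₁ ⊗ f₄) ⊗ (f₄ ⊗ f₂₀)) ⊗ a) ⊜ ((a ⊗ (f₁ ⊗ (f₄ ⊗ (f₄ ⊗ id)))) ⊗ f₂₀)) M.refl a f₁ f₄ f₂₀ ⟩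
    (a ∙ (f₁ ∙ (f₄ ∙ (f₄ ∙ ε)))) ∙ f₂₀
      ≈⟨ ∙-congʳ p ⟩
    ((f₂ ∙ (f₂ ∙ ε)) ∙ f₅) ∙ f₂₀
      ≈⟨ ∙-congʳ (∙-congʳ (∙-congˡ (identityʳ f₂))) ⟩
    ((f₂ ∙ f₂) ∙ f₅) ∙ f₂₀ ∎
    where open SetoidReasoning M.setoid

-- The ring of formal power series

infix 4 _≈_ _≈[_]_
infixl 6 _⊕_
infix 8 ⊝_

-- A record, so that both series can be inferred from the type of a proof; a bare pointwise equality
-- of coefficients would not determine them.
record _≈_ (u v : Series) : Set where
  constructor exactly
  field coeff : u ≗ v
open _≈_

-- Congruence modulo `q^N`, the form in which all limits are taken.
record _≈[_]_ (u : Series) (N : ℕ) (v : Series) : Set where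
  constructor below
  field coeff< : ∀ {n} → n ℕ.< N → u n ≡ v n
open _≈[_]_

𝟘 : Series
𝟘 _ = 0ℤ

_⊕_ : Series → Series → Series
(u ⊕ v) n = u n + v n

⊝_ : Series → Series
(⊝ u) n = - u n

tail : Series → Series
tail u n = u (suc n)

·-cong-upto : ∀ {u u′ v v′} n → (∀ {m} → m ℕ.≤ n → u m ≡ u′ m) → (∀ {m} → m ℕ.≤ n → v m ≡ v′ m) →
          (u · v) n ≡ (u′ · v′) n
·-cong-upto zero p q = cong₂ (λ x y → x * y + 0ℤ) (p z≤n) (q z≤n)
·-cong-upto {u} {u′} (suc n) p q = cong₂ _+_ (cong₂ _*_ (p z≤n) (q ℕ.≤-refl))
  (·-cong-upto {tail u} {tail u′} n (λ m≤n → p (s≤s m≤n)) (λ m≤n → q (ℕ.m≤n⇒m≤1+n m≤n)))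

·-distribʳ : ∀ w u v n → ((u ⊕ v) · w) n ≡ (u · w) n + (v · w) n
·-distribʳ w u v zero = go (u 0) (v 0) (w 0)
  where
  go : ∀ x y z → (x + y) * z + 0ℤ ≡ (x * z + 0ℤ) + (y * z + 0ℤ)
  go = ℤSolver.solve-∀
·-distribʳ w u v (suc n) = trans (cong (λ z → (u 0 + v 0) * w (suc n) + z) (·-distribʳ w (tail u) (tail v) n))
  (go (u 0) (v 0) (w (suc n)) _ _)
  where
  go : ∀ x y z r s → (x + y) * z + (r + s) ≡ (x * z + r) + (y * z + s)
  go = ℤSolver.solve-∀

-- The convolution unfolds at its left end by definition; peeling off the right end as well turns
-- commutativity into an induction.
·-sucʳ : ∀ u v n → (u · v) (suc n) ≡ (u · tail v) n + u (suc n) * v 0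
·-sucʳ u v zero = go (u 0) (u 1) (v 0) (v 1)
  where
  go : ∀ x x′ y y′ → x * y′ + (x′ * y + 0ℤ) ≡ (x * y′ + 0ℤ) + x′ * y
  go = ℤSolver.solve-∀
·-sucʳ u v (suc n) = trans (cong (λ z → u 0 * v (suc (suc n)) + z) (·-sucʳ (tail u) v n))
  (sym (ℤ.+-assoc (u 0 * v (suc (suc n))) _ _))

·-comm : ∀ u v n → (u · v) n ≡ (v · u) n
·-comm u v zero = cong (_+ 0ℤ) (ℤ.*-comm (u 0) (v 0))
·-comm u v (suc n) = trans (cong₂ _+_ (ℤ.*-comm (u 0) (v (suc n))) (·-comm (tail u) v n))
  (trans (ℤ.+-comm (v (suc n) * u 0) _) (sym (·-sucʳ v u n)))

·-scale : ∀ c u v n → ((λ k → c * u k) · v) n ≡ c * (u · v) n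
·-scale c u v zero = go c (u 0) (v 0)
  where
  go : ∀ c x y → c * x * y + 0ℤ ≡ c * (x * y + 0ℤ)
  go = ℤSolver.solve-∀
·-scale c u v (suc n) = trans (cong (λ z → c * u 0 * v (suc n) + z) (·-scale c (tail u) v n))
  (go c (u 0) (v (suc n)) _)
  where
  go : ∀ c x y z → c * x * y + c * z ≡ c * (x * y + z)
  go = ℤSolver.solve-∀

·-assoc : ∀ u v w n → ((u · v) · w) n ≡ (u · (v · w)) n
·-assoc u v w zero = go (u 0) (v 0) (w 0)
  where
  go : ∀ x y z → (x * y + 0ℤ) * z + 0ℤ ≡ x * (y * z + 0ℤ) + 0ℤ
  go = ℤSolver.solve-∀
·-assoc u v w (suc n) = begin
  (u 0 * v 0 + 0ℤ) * w (suc n) + (tail (u · v) · w) n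
    ≡⟨ cong (λ z → (u 0 * v 0 + 0ℤ) * w (suc n) + z) (·-distribʳ w (λ k → u 0 * v (suc k)) (tail u · v) n) ⟩
  (u 0 * v 0 + 0ℤ) * w (suc n) + (((λ k → u 0 * tail v k) · w) n + ((tail u · v) · w) n)
    ≡⟨ cong₂ (λ x y → (u 0 * v 0 + 0ℤ) * w (suc n) + (x + y)) (·-scale (u 0) (tail v) w n) (·-assoc (tail u) v w n) ⟩
  (u 0 * v 0 + 0ℤ) * w (suc n) + (u 0 * (tail v · w) n + (tail u · (v · w)) n)
    ≡⟨ go (u 0) (v 0) (w (suc n)) _ _ ⟩
  u 0 * (v · w) (suc n) + (tail u · (v · w)) n ∎
  where
  open ≡-Reasoning
  go : ∀ x y z r s → (x * y + 0ℤ) * z + (x * r + s) ≡ x * (y * z + r) + s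
  go = ℤSolver.solve-∀

·-zeroˡ : ∀ u n → (𝟘 · u) n ≡ 0ℤ
·-zeroˡ u zero = refl
·-zeroˡ u (suc n) = trans (ℤ.+-identityˡ _) (·-zeroˡ u n)

·-identityˡ : ∀ u n → (𝟙 · u) n ≡ u n
·-identityˡ u zero = trans (ℤ.+-identityʳ _) (ℤ.*-identityˡ (u 0))
·-identityˡ u (suc n) = trans (cong₂ _+_ (ℤ.*-identityˡ (u (suc n))) (·-zeroˡ u n)) (ℤ.+-identityʳ _)

infixl 7 _∙_

-- Opaque, so that unification of products does not unfold the convolution.
opaque
  _∙_ : Series → Series → Series
  _∙_ = _·_

  ∙≡· : ∀ u v → u ∙ v ≡ u · v
  ∙≡· u v = refl

  ∙-at-0 : ∀ u v → (u ∙ v) 0 ≡ u 0 * v 0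
  ∙-at-0 u v = ℤ.+-identityʳ (u 0 * v 0)

  ∙-at-suc : ∀ u v n → (u ∙ v) (suc n) ≡ u 0 * v (suc n) + (tail u ∙ v) n
  ∙-at-suc u v n = refl

  ∙-cong-upto : ∀ {u u′ v v′} n → (∀ {m} → m ℕ.≤ n → u m ≡ u′ m) → (∀ {m} → m ℕ.≤ n → v m ≡ v′ m) →
                (u ∙ v) n ≡ (u′ ∙ v′) n
  ∙-cong-upto = ·-cong-upto

  ∙-isCommutativeRing : IsCommutativeRing _≈_ _⊕_ _∙_ ⊝_ 𝟘 𝟙
  ∙-isCommutativeRing = record
    { isRing = record
      { +-isAbelianGroup = record
        { isGroup = record
          { isMonoid = record
            { isSemigroup = record
              { isMagma = record
                { isEquivalence = record
                  { refl = exactly λ _ → refl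
                  ; sym = λ p → exactly λ n → sym (coeff p n)
                  ; trans = λ p q → exactly λ n → trans (coeff p n) (coeff q n) }
                ; ∙-cong = λ p q → exactly λ n → cong₂ _+_ (coeff p n) (coeff q n) }
              ; assoc = λ u v w → exactly λ n → ℤ.+-assoc (u n) (v n) (w n) }
            ; identity = (λ u → exactly λ n → ℤ.+-identityˡ (u n)) , (λ u → exactly λ n → ℤ.+-identityʳ (u n)) }
          ; inverse = (λ u → exactly λ n → ℤ.+-inverseˡ (u n)) , (λ u → exactly λ n → ℤ.+-inverseʳ (u n))
          ; ⁻¹-cong = λ p → exactly λ n → cong -_ (coeff p n) }
        ; comm = λ u v → exactly λ n → ℤ.+-comm (u n) (v n) }
      ; *-cong = λ p q → exactly λ n → ·-cong-upto n (λ {m} _ → coeff p m) (λ {m} _ → coeff q m)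
      ; *-assoc = λ u v w → exactly (·-assoc u v w)
      ; *-identity = (λ u → exactly (·-identityˡ u)) , (λ u → exactly λ n → trans (·-comm u 𝟙 n) (·-identityˡ u n))
      ; distrib = (λ w u v → exactly λ n → trans (·-comm w (u ⊕ v) n)
                    (trans (·-distribʳ w u v n) (cong₂ _+_ (·-comm u w n) (·-comm v w n))))
                , (λ w u v → exactly (·-distribʳ w u v)) }
    ; *-comm = λ u v → exactly (·-comm u v) }

seriesRing : CommutativeRing _ _
seriesRing = record { isCommutativeRing = ∙-isCommutativeRing }

open CommutativeRing seriesRing
  using (+-cong; *-cong; *-congˡ; *-congʳ; *-identityˡ; *-identityʳ; *-comm; *-assoc; distribˡ; distribʳ; zeroˡ; zeroʳ)
  renaming (refl to ≈-refl; sym to ≈-sym; trans to ≈-trans; reflexive to ≈-reflexive)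

module ≈-Reasoning = SetoidReasoning (CommutativeRing.setoid seriesRing)
open Rearrange (CommutativeRing.*-commutativeMonoid seriesRing)
open Algebra.Properties.Ring (CommutativeRing.ring seriesRing) using ([y-z]x≈yx-zx; x[y-z]≈xy-xz)
module ∙ = Algebra.Properties.CommutativeSemigroup (CommutativeRing.*-commutativeSemigroup seriesRing)
module ⊕ = Algebra.Properties.CommutativeSemigroup (CommutativeRing.+-commutativeSemigroup seriesRing)

-- Congruence modulo powers of q

≈[]-refl : ∀ {N u} → u ≈[ N ] u
≈[]-refl = below λ _ → refl

≈[]-sym : ∀ {N u v} → u ≈[ N ] v → v ≈[ N ] u
≈[]-sym p = below λ n<N → sym (coeff< p n<N)

≈[]-trans : ∀ {N u v w} → u ≈[ N ] v → v ≈[ N ] w → u ≈[ N ] w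
≈[]-trans p q = below λ n<N → trans (coeff< p n<N) (coeff< q n<N)

truncate : ∀ {N u v} → u ≈ v → u ≈[ N ] v
truncate p = below λ {n} _ → coeff p n

untruncate : ∀ {u v} → (∀ N → u ≈[ suc N ] v) → u ≈ v
untruncate p = exactly λ n → coeff< (p n) (ℕ.n<1+n n)

weaken : ∀ {M N u v} → N ℕ.≤ M → u ≈[ M ] v → u ≈[ N ] v
weaken N≤M p = below λ n<N → coeff< p (ℕ.<-≤-trans n<N N≤M)

⊕-cong[] : ∀ {N u u′ v v′} → u ≈[ N ] u′ → v ≈[ N ] v′ → u ⊕ v ≈[ N ] u′ ⊕ v′
⊕-cong[] p q = below λ n<N → cong₂ _+_ (coeff< p n<N) (coeff< q n<N)

∙-cong[] : ∀ {N u u′ v v′} → u ≈[ N ] u′ → v ≈[ N ] v′ → u ∙ v ≈[ N ] u′ ∙ v′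
∙-cong[] p q = below λ {n} n<N → ∙-cong-upto n
  (λ m≤n → coeff< p (ℕ.≤-<-trans m≤n n<N)) (λ m≤n → coeff< q (ℕ.≤-<-trans m≤n n<N))

truncatedSetoid : ℕ → Setoid _ _
truncatedSetoid N = record
  { _≈_ = _≈[ N ]_
  ; isEquivalence = record { refl = ≈[]-refl ; sym = ≈[]-sym ; trans = ≈[]-trans } }

module ≈[]-Reasoning (N : ℕ) = SetoidReasoning (truncatedSetoid N)

-- A series with constant term 1 is a unit with inverse `𝟙 ÷ w`, and multiplication by a unit's
-- inverse preserves congruences.
∙-cancelˡ[] : ∀ {N} w {u v} → w 0 ≡ 1ℤ → w ∙ u ≈[ N ] w ∙ v → u ≈[ N ] v
∙-cancelˡ[] {N} w {u} {v} w₀≡1 p = ≈[]-trans (≈[]-sym (truncate (cancel u)))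
  (≈[]-trans (∙-cong[] {u = 𝟙 ÷ w} ≈[]-refl p) (truncate (cancel v)))
  where
  cancel : ∀ x → (𝟙 ÷ w) ∙ (w ∙ x) ≈ x
  cancel x = ≈-trans (≈-sym (*-assoc (𝟙 ÷ w) w x))
    (≈-trans (*-congʳ {x} (exactly λ n → trans (cong (_$ n) (∙≡· (𝟙 ÷ w) w)) (÷-correct 𝟙 w w₀≡1 n))) (*-identityˡ x))

∙-cancelˡ : ∀ w {u v} → w 0 ≡ 1ℤ → w ∙ u ≈ w ∙ v → u ≈ v
∙-cancelˡ w w₀≡1 p = untruncate λ N → ∙-cancelˡ[] w w₀≡1 (truncate p)

∙-constant : ∀ {u v} → u 0 ≡ 1ℤ → v 0 ≡ 1ℤ → (u ∙ v) 0 ≡ 1ℤ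
∙-constant {u} {v} p q = trans (∙-at-0 u v) (cong₂ _*_ p q)

shift-0 : ∀ m u → (q^ suc m ∙ u) 0 ≡ 0ℤ
shift-0 m u = ∙-at-0 (q^ suc m) u

shift-suc : ∀ m u n → (q^ suc m ∙ u) (suc n) ≡ (q^ m ∙ u) n
shift-suc m u n = trans (∙-at-suc (q^ suc m) u n) (ℤ.+-identityˡ _)

shift-below : ∀ m u {n} → n ℕ.< m → (q^ m ∙ u) n ≡ 0ℤ
shift-below (suc m) u {zero}  _         = shift-0 m u
shift-below (suc m) u {suc n} (s≤s n<m) = trans (shift-suc m u n) (shift-below m u n<m)

shift-+ : ∀ m u n → (q^ m ∙ u) (m ℕ.+ n) ≡ u n
shift-+ zero    u n = coeff (*-identityˡ u) n
shift-+ (suc m) u n = trans (shift-suc m u (m ℕ.+ n)) (shift-+ m u n)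

q^-below : ∀ m → q^ m ≈[ m ] 𝟘
q^-below m = below λ n<m → q^-≢ m _ (ℕ.<⇒≢ n<m)

-- Multiplication by `q^m` gains m orders of precision, so the coefficient of a late theta term need
-- only be known roughly.
shift-cong : ∀ m {k N u v} → N ℕ.≤ m ℕ.+ k → u ≈[ k ] v → q^ m ∙ u ≈[ N ] q^ m ∙ v
shift-cong m {k} {N} {u} {v} N≤m+k p = below λ {n} n<N → go n (ℕ.<-≤-trans n<N N≤m+k)
  where
  go : ∀ n → n ℕ.< m ℕ.+ k → (q^ m ∙ u) n ≡ (q^ m ∙ v) n
  go n n<m+k with n ℕ.<? m
  ... | yes n<m = trans (shift-below m u n<m) (sym (shift-below m v n<m))
  ... | no  n≮m with i , refl ← ℕ.m≤n⇒∃[o]m+o≡n (ℕ.≮⇒≥ n≮m) =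
    trans (shift-+ m u i) (trans (coeff< p (ℕ.+-cancelˡ-< m i k n<m+k)) (sym (shift-+ m v i)))

q^-+ : ∀ m n → q^ m ∙ q^ n ≈ q^ (m ℕ.+ n)
q^-+ m n = exactly (go m)
  where
  go : ∀ m i → (q^ m ∙ q^ n) i ≡ (q^ (m ℕ.+ n)) i
  go zero    i       = coeff (*-identityˡ (q^ n)) i
  go (suc m) zero    = shift-0 m (q^ n)
  go (suc m) (suc i) = trans (shift-suc m (q^ n) i) (go m i)

-- Infinite products

partial : (ℕ → Series) → ℕ → Series
partial g zero    = 𝟙
partial g (suc N) = g N ∙ partial g N

Π : (ℕ → Series) → Series
Π g n = partial g n n

-- The factors from index n on are 1 modulo `q^(n+1)`, so coefficient n is settled by the first n
-- factors; this makes the diagonal definition of `Π` the limit of the partial products.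
Convergent : (ℕ → Series) → Set
Convergent g = ∀ k → g k ≈[ suc k ] 𝟙

partial-cong : ∀ {g h} → (∀ k → g k ≈ h k) → ∀ N → partial g N ≈ partial h N
partial-cong p zero    = ≈-refl
partial-cong p (suc N) = *-cong (p N) (partial-cong p N)

partial-∙ : ∀ g h N → partial (λ k → g k ∙ h k) N ≈ partial g N ∙ partial h N
partial-∙ g h zero    = ≈-sym (*-identityˡ 𝟙)
partial-∙ g h (suc N) = ≈-trans (*-cong (≈-refl {g N ∙ h N}) (partial-∙ g h N)) (∙.interchange (g N) (h N) (partial g N) (partial h N))

partial-+ : ∀ g M N → partial g (M ℕ.+ N) ≈ partial (λ r → g (r ℕ.+ N)) M ∙ partial g N
partial-+ g zero    N = ≈-sym (*-identityˡ (partial g N))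
partial-+ g (suc M) N = ≈-trans (*-cong (≈-refl {g (M ℕ.+ N)}) (partial-+ g M N))
  (≈-sym (*-assoc (g (M ℕ.+ N)) _ (partial g N)))

partial-front : ∀ g N → partial g (suc N) ≈ g 0 ∙ partial (g ∘ suc) N
partial-front g zero    = ≈-refl
partial-front g (suc N) = ≈-trans (*-congˡ {g (suc N)} (partial-front g N)) (∙.x∙yz≈y∙xz (g (suc N)) (g 0) (partial (g ∘ suc) N))

partial-≈𝟙 : ∀ {g N} m → (∀ k → g k ≈[ N ] 𝟙) → partial g m ≈[ N ] 𝟙
partial-≈𝟙 zero    p = ≈[]-refl
partial-≈𝟙 (suc m) p = ≈[]-trans (∙-cong[] (p m) (partial-≈𝟙 m p)) (truncate (*-identityˡ 𝟙))

Π-partial : ∀ {g N M} → Convergent g → N ℕ.≤ M → Π g ≈[ suc N ] partial g M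
Π-partial {g} conv N≤M = below λ { (s≤s n≤N) →
  sym (coeff< (stable (ℕ.≤⇒≤′ (ℕ.≤-trans n≤N N≤M))) (ℕ.n<1+n _)) }
  where
  stable : ∀ {n M} → n ℕ.≤′ M → partial g M ≈[ suc n ] partial g n
  stable ℕ.≤′-refl = ≈[]-refl
  stable {n} (ℕ.≤′-step {M} n≤′M) = ≈[]-trans
    (∙-cong[] (weaken (s≤s (ℕ.≤′⇒≤ n≤′M)) (conv M)) (stable n≤′M))
    (truncate (*-identityˡ (partial g n)))

-- The limit may be taken along the subsequence `φ`, since `φ N` is at least `N`.
Π-reindex : ∀ {g h} (φ : ℕ → ℕ) → Convergent g → Convergent h → (∀ N → N ℕ.≤ φ N) →
            (∀ N → partial g (φ N) ≈ partial h N) → Π g ≈ Π h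
Π-reindex φ conv-g conv-h N≤φN p = untruncate λ N →
  ≈[]-trans (Π-partial conv-g (N≤φN N))
    (≈[]-trans (truncate (p N)) (≈[]-sym (Π-partial conv-h ℕ.≤-refl)))

Π-cong : ∀ {g h} → (∀ k → g k ≈ h k) → Π g ≈ Π h
Π-cong p = exactly λ n → coeff (partial-cong p n) n

Π-𝟙 : Π (λ _ → 𝟙) ≈ 𝟙
Π-𝟙 = exactly λ n → coeff (partial-𝟙 n) n
  where
  partial-𝟙 : ∀ N → partial (λ _ → 𝟙) N ≈ 𝟙
  partial-𝟙 zero    = ≈-refl
  partial-𝟙 (suc N) = ≈-trans (*-identityˡ _) (partial-𝟙 N)

Π-∙ : ∀ {g h} → Convergent g → Convergent h → Π (λ k → g k ∙ h k) ≈ Π g ∙ Π h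
Π-∙ {g} {h} conv-g conv-h = untruncate λ N → ≈[]-trans
  (Π-partial (λ k → ≈[]-trans (∙-cong[] (conv-g k) (conv-h k)) (truncate (*-identityˡ 𝟙))) (ℕ.≤-refl {N}))
  (≈[]-trans (truncate (partial-∙ g h N))
    (≈[]-sym (∙-cong[] (Π-partial conv-g ℕ.≤-refl) (Π-partial conv-h ℕ.≤-refl))))

Π-exchange : ∀ {G : ℕ → ℕ → Series} m → (∀ r → Convergent (G r)) →
             Π (λ k → partial (λ r → G r k) m) ≈ partial (λ r → Π (G r)) m
Π-exchange zero    conv = Π-𝟙
Π-exchange {G} (suc m) conv = ≈-trans
  (Π-∙ (conv m) (λ k → partial-≈𝟙 m (λ r → conv r k)))
  (*-cong (≈-refl {Π (G m)}) (Π-exchange m conv))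

-- Cutting the factors into consecutive blocks of length m and collecting the r-th factor of each
-- block sorts them by residue modulo m.
Π-blocks : ∀ {g} m .{{_ : NonZero m}} → Convergent g →
           Π g ≈ partial (λ r → Π (λ k → g (r ℕ.+ k ℕ.* m))) m
Π-blocks {g} m conv = ≈-trans
  (Π-reindex (ℕ._* m) conv (λ k → partial-≈𝟙 m (λ r → conv-block r k)) (λ N → ℕ.m≤m*n N m) partial-blocks)
  (Π-exchange m conv-block)
  where
  conv-block : ∀ r → Convergent (λ k → g (r ℕ.+ k ℕ.* m))
  conv-block r k = weaken (s≤s (ℕ.≤-trans (ℕ.m≤m*n k m) (ℕ.m≤n+m (k ℕ.* m) r))) (conv (r ℕ.+ k ℕ.* m))

  partial-blocks : ∀ N → partial g (N ℕ.* m) ≈ partial (λ k → partial (λ r → g (r ℕ.+ k ℕ.* m)) m) N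
  partial-blocks zero    = ≈-refl
  partial-blocks (suc N) = ≈-trans (partial-+ g m (N ℕ.* m))
    (*-cong (≈-refl {partial (λ r → g (r ℕ.+ N ℕ.* m)) m}) (partial-blocks N))

-- A common interface for 1 + q^e, 1 - q^e and 1 / (1 - q^e), so that convergence and the splitting
-- into residue classes are proved once for all three.
record Factors (φ : ℕ → Series) : Set where
  field φ≈𝟙 : ∀ e → φ e ≈[ e ] 𝟙
open Factors {{...}}

progression : (ℕ → Series) → ℕ → ℕ → Series
progression φ c a = Π (λ k → φ (a ℕ.+ k ℕ.* c))

progression-convergent : ∀ φ {{_ : Factors φ}} c a .{{_ : NonZero c}} .{{_ : NonZero a}} →
                         Convergent (λ k → φ (a ℕ.+ k ℕ.* c))
progression-convergent φ c a k = weaken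
  (ℕ.+-mono-≤ (ℕ.>-nonZero⁻¹ a) (ℕ.m≤m*n k c)) (φ≈𝟙 (a ℕ.+ k ℕ.* c))

progression-blocks : ∀ φ {{_ : Factors φ}} c a m .{{_ : NonZero c}} .{{_ : NonZero a}} .{{_ : NonZero m}} →
                     progression φ c a ≈ partial (λ r → progression φ (m ℕ.* c) (a ℕ.+ r ℕ.* c)) m
progression-blocks φ c a m = ≈-trans (Π-blocks m (progression-convergent φ c a))
  (partial-cong (λ r → Π-cong λ k → ≈-reflexive (cong φ (index a r k m c))) m)
  where
  index : ∀ a r k m c → a ℕ.+ (r ℕ.+ k ℕ.* m) ℕ.* c ≡ (a ℕ.+ r ℕ.* c) ℕ.+ k ℕ.* (m ℕ.* c)
  index = ℕSolver.solve-∀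

-- For positive e, `geometric e` is 1 / (1 - q^e), given as the indicator of the multiples of e so
-- that its signs and support can be read off; `geometric-inverse` justifies the name.
φ⁺ φ⁻ geometric : ℕ → Series
φ⁺ e = 𝟙 ⊕ q^ e
φ⁻ e = 𝟙 ⊖ q^ e
geometric e n = if does (e ∣? n) then 1ℤ else 0ℤ

instance
  φ⁺-factors : Factors φ⁺
  φ⁺-factors = record { φ≈𝟙 = λ e → below λ {n} n<e → trans (cong (λ z → 𝟙 n + z) (coeff< (q^-below e) n<e)) (ℤ.+-identityʳ (𝟙 n)) }

  φ⁻-factors : Factors φ⁻
  φ⁻-factors = record { φ≈𝟙 = λ e → below λ {n} n<e → trans (cong (λ x → 𝟙 n + - x) (coeff< (q^-below e) n<e)) (ℤ.+-identityʳ (𝟙 n)) }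

geometric-∣ : ∀ {e n} → e ∣ n → geometric e n ≡ 1ℤ
geometric-∣ {e} {n} e∣n = cong (if_then 1ℤ else 0ℤ) (dec-true (e ∣? n) e∣n)

geometric-below : ∀ e → geometric e ≈[ e ] 𝟙
geometric-below e = below go
  where
  go : ∀ {n} → n ℕ.< e → geometric e n ≡ 𝟙 n
  go {zero}  _   = geometric-∣ (e ∣0)
  go {suc n} n<e = cong (if_then 1ℤ else 0ℤ) (dec-false (e ∣? suc n) λ e∣n → ℕ.<⇒≱ n<e (∣⇒≤ e∣n))

instance
  geometric-factors : Factors geometric
  geometric-factors = record { φ≈𝟙 = geometric-below }

geometric-suc : ∀ e .{{_ : NonZero e}} → geometric e ≈ 𝟙 ⊕ q^ e ∙ geometric e
geometric-suc e = exactly go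
  where
  go : ∀ n → geometric e n ≡ 𝟙 n + (q^ e ∙ geometric e) n
  go n with n ℕ.<? e
  ... | yes n<e = trans (coeff< (geometric-below e) n<e)
                    (sym (trans (cong (λ z → 𝟙 n + z) (shift-below e (geometric e) n<e)) (ℤ.+-identityʳ (𝟙 n))))
  ... | no  n≮e with i , refl ← ℕ.m≤n⇒∃[o]m+o≡n (ℕ.≮⇒≥ n≮e) =
    trans periodic (sym (cong₂ _+_ (q^-≢ 0 (e ℕ.+ i) (λ e+i≡0 → ℕ.≢-nonZero⁻¹ e (ℕ.m+n≡0⇒m≡0 e e+i≡0)))
                                   (shift-+ e (geometric e) i)))
    where
    periodic : geometric e (e ℕ.+ i) ≡ 0ℤ + geometric e i
    periodic with e ∣? i
    ... | yes e∣i = geometric-∣ (∣m∣n⇒∣m+n ∣-refl e∣i)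
    ... | no  e∤i = cong (if_then 1ℤ else 0ℤ) (dec-false (e ∣? (e ℕ.+ i)) λ d → e∤i (∣m+n∣m⇒∣n d ∣-refl))

φ⁺-∙ : ∀ e u → φ⁺ e ∙ u ≈ q^ e ∙ u ⊕ u
φ⁺-∙ e u = ≈-trans (distribʳ u 𝟙 (q^ e)) (exactly λ n →
  trans (cong (_+ (q^ e ∙ u) n) (coeff (*-identityˡ u) n)) (ℤ.+-comm (u n) _))

geometric-inverse : ∀ e .{{_ : NonZero e}} → geometric e ∙ φ⁻ e ≈ 𝟙
geometric-inverse e = begin
  geometric e ∙ φ⁻ e                       ≈⟨ *-comm (geometric e) (φ⁻ e) ⟩
  φ⁻ e ∙ geometric e                       ≈⟨ [y-z]x≈yx-zx (geometric e) 𝟙 (q^ e) ⟩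
  (𝟙 ∙ geometric e) ⊖ (q^ e ∙ geometric e) ≈⟨ exactly (λ n → cong (_+ - (q^ e ∙ geometric e) n) (trans (coeff (*-identityˡ (geometric e)) n) (coeff (geometric-suc e) n))) ⟩
  (𝟙 ⊕ q^ e ∙ geometric e) ⊖ (q^ e ∙ geometric e) ≈⟨ exactly (λ n → cancel (𝟙 n) ((q^ e ∙ geometric e) n)) ⟩
  𝟙 ∎
  where
  open ≈-Reasoning
  cancel : ∀ x y → (x + y) + - y ≡ x
  cancel x y = trans (ℤ.+-assoc x y (- y)) (trans (cong (λ z → x + z) (ℤ.+-inverseʳ y)) (ℤ.+-identityʳ x))

φ⁻-double : ∀ e → φ⁻ (e ℕ.+ e) ≈ φ⁻ e ∙ φ⁺ e
φ⁻-double e = ≈-sym (begin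
  φ⁻ e ∙ φ⁺ e                                ≈⟨ [y-z]x≈yx-zx (φ⁺ e) 𝟙 (q^ e) ⟩
  (𝟙 ∙ φ⁺ e) ⊖ (q^ e ∙ φ⁺ e)                 ≈⟨ exactly (λ n → cong₂ (λ x y → x + - y) (coeff (*-identityˡ (φ⁺ e)) n) (coeff expand n)) ⟩
  (𝟙 ⊕ q^ e) ⊖ (q^ e ⊕ q^ (e ℕ.+ e))         ≈⟨ exactly (λ n → cancel (𝟙 n) ((q^ e) n) ((q^ (e ℕ.+ e)) n)) ⟩
  φ⁻ (e ℕ.+ e)                               ∎)
  where
  open ≈-Reasoning
  expand : q^ e ∙ φ⁺ e ≈ q^ e ⊕ q^ (e ℕ.+ e)
  expand = ≈-trans (distribˡ (q^ e) 𝟙 (q^ e)) (+-cong (*-identityʳ (q^ e)) (q^-+ e e))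
  cancel : ∀ x y z → (x + y) + - (y + z) ≡ x + - z
  cancel = ℤSolver.solve-∀

-- (q^a; q^c)_∞ and (-q^a; q^c)_∞
⟨_⨾_⟩⁻ ⟨_⨾_⟩⁺ : ℕ → ℕ → Series
⟨ a ⨾ c ⟩⁻ = progression φ⁻ c a
⟨ a ⨾ c ⟩⁺ = progression φ⁺ c a

f-progression : ∀ j .{{_ : NonZero j}} → f j ≈ ⟨ j ⨾ j ⟩⁻
f-progression j = exactly λ n → coeff (go n) n
  where
  go : ∀ N → partialProduct j N ≈ partial (λ k → φ⁻ (j ℕ.+ k ℕ.* j)) N
  go zero    = ≈-refl
  go (suc N) = ≈-trans (≈-reflexive (sym (∙≡· (φ⁻ (j ℕ.* suc N)) (partialProduct j N))))
    (*-cong (≈-reflexive (cong φ⁻ (ℕ.*-comm j (suc N)))) (go N))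

progression-double : ∀ c a .{{_ : NonZero c}} .{{_ : NonZero a}} →
                     ⟨ (a ℕ.+ a) ⨾ (c ℕ.+ c) ⟩⁻ ≈ ⟨ a ⨾ c ⟩⁻ ∙ ⟨ a ⨾ c ⟩⁺
progression-double c a = ≈-trans
  (Π-cong λ k → ≈-trans (≈-reflexive (cong φ⁻ (index a c k))) (φ⁻-double (a ℕ.+ k ℕ.* c)))
  (Π-∙ (progression-convergent φ⁻ c a) (progression-convergent φ⁺ c a))
  where
  index : ∀ a c k → (a ℕ.+ a) ℕ.+ k ℕ.* (c ℕ.+ c) ≡ (a ℕ.+ k ℕ.* c) ℕ.+ (a ℕ.+ k ℕ.* c)
  index = ℕSolver.solve-∀

progression-inverse : ∀ c a .{{_ : NonZero c}} .{{_ : NonZero a}} →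
                      progression geometric c a ∙ ⟨ a ⨾ c ⟩⁻ ≈ 𝟙
-- Matching on the successor makes `a + k * c` reduce to a successor, which supplies the `NonZero`
-- instance for `geometric-inverse`.
progression-inverse c a@(suc a-1) = ≈-trans
  (≈-sym (Π-∙ (progression-convergent geometric c a) (progression-convergent φ⁻ c a)))
  (≈-trans (Π-cong λ k → geometric-inverse (a ℕ.+ k ℕ.* c)) Π-𝟙)

-- Finite sums of series

⅀ : ∀ {A : Set} → List A → (A → Series) → Series
⅀ []       g = 𝟘
⅀ (x ∷ xs) g = g x ⊕ ⅀ xs g

sumTo : (ℕ → Series) → ℕ → Series
sumTo g zero    = 𝟘
sumTo g (suc N) = g 0 ⊕ sumTo (g ∘ suc) N

sumTo-cong : ∀ {g h} N → (∀ i → g i ≈ h i) → sumTo g N ≈ sumTo h N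
sumTo-cong zero    p = ≈-refl
sumTo-cong (suc N) p = +-cong (p 0) (sumTo-cong N (p ∘ suc))

sumTo-cong[] : ∀ {g h M} N → (∀ {i} → i ℕ.< N → g i ≈[ M ] h i) → sumTo g N ≈[ M ] sumTo h N
sumTo-cong[] zero    p = ≈[]-refl
sumTo-cong[] (suc N) p = ⊕-cong[] (p (s≤s z≤n)) (sumTo-cong[] N (p ∘ s≤s))

sumTo-⊕ : ∀ g h N → sumTo (λ i → g i ⊕ h i) N ≈ sumTo g N ⊕ sumTo h N
sumTo-⊕ g h zero    = exactly λ _ → refl
sumTo-⊕ g h (suc N) = ≈-trans (+-cong (≈-refl {g 0 ⊕ h 0}) (sumTo-⊕ (g ∘ suc) (h ∘ suc) N)) (⊕.interchange (g 0) (h 0) _ _)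

sumTo-∙ : ∀ w g N → w ∙ sumTo g N ≈ sumTo (λ i → w ∙ g i) N
sumTo-∙ w g zero    = zeroʳ w
sumTo-∙ w g (suc N) = ≈-trans (distribˡ w (g 0) _) (+-cong (≈-refl {w ∙ g 0}) (sumTo-∙ w (g ∘ suc) N))

sumTo-last : ∀ g N → g N ≈ 𝟘 → sumTo g (suc N) ≈ sumTo g N
sumTo-last g zero    p = exactly λ n → trans (ℤ.+-identityʳ (g 0 n)) (coeff p n)
sumTo-last g (suc N) p = +-cong (≈-refl {g 0}) (sumTo-last (g ∘ suc) N p)

⅀-applyUpTo : ∀ {A : Set} (h : ℕ → A) N g → ⅀ (applyUpTo h N) g ≈ sumTo (g ∘ h) N
⅀-applyUpTo h zero    g = ≈-refl
⅀-applyUpTo h (suc N) g = +-cong (≈-refl {g (h 0)}) (⅀-applyUpTo (h ∘ suc) N g)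

-- Gaussian binomial coefficients in base q^c

module Gaussian (c : ℕ) where

  -- Defined by the q-Pascal rule, which involves no division; the quotient formula is recovered in
  -- product form by `gauss-factorials`.
  gauss : ℕ → ℕ → Series
  gauss M       zero    = 𝟙
  gauss zero    (suc i) = 𝟘
  gauss (suc M) (suc i) = gauss M i ⊕ q^ (suc i ℕ.* c) ∙ gauss M (suc i)

  gauss-> : ∀ {M i} → M ℕ.< i → gauss M i ≈ 𝟘
  gauss-> {zero}  {suc i} _         = ≈-refl
  gauss-> {suc M} {suc i} (s≤s M<i) = begin
    gauss M i ⊕ q^ (suc i ℕ.* c) ∙ gauss M (suc i) ≈⟨ +-cong (gauss-> M<i) (*-congˡ {q^ (suc i ℕ.* c)} (gauss-> (ℕ.m<n⇒m<1+n M<i))) ⟩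
    𝟘 ⊕ q^ (suc i ℕ.* c) ∙ 𝟘                       ≈⟨ exactly (λ n → ℤ.+-identityˡ _) ⟩
    q^ (suc i ℕ.* c) ∙ 𝟘                           ≈⟨ zeroʳ (q^ (suc i ℕ.* c)) ⟩
    𝟘                                              ∎
    where open ≈-Reasoning

  gauss-diagonal : ∀ M → gauss M M ≈ 𝟙
  gauss-diagonal zero    = ≈-refl
  gauss-diagonal (suc M) = begin
    gauss M M ⊕ q^ (suc M ℕ.* c) ∙ gauss M (suc M) ≈⟨ +-cong (gauss-diagonal M) (*-congˡ {q^ (suc M ℕ.* c)} (gauss-> (ℕ.n<1+n M))) ⟩
    𝟙 ⊕ q^ (suc M ℕ.* c) ∙ 𝟘                       ≈⟨ +-cong (≈-refl {𝟙}) (zeroʳ (q^ (suc M ℕ.* c))) ⟩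
    𝟙 ⊕ 𝟘                                          ≈⟨ exactly (λ n → ℤ.+-identityʳ (𝟙 n)) ⟩
    𝟙                                              ∎
    where open ≈-Reasoning

  -- Pascal's rule summed against arbitrary weights. It is the inductive step of both `q-binomial`
  -- and `finite-jacobi`, where one more factor 1 + q^d produces exactly these two sums.
  gauss-sum-suc : ∀ M (x : ℕ → Series) →
    sumTo (λ i → gauss (suc M) i ∙ x i) (suc (suc M)) ≈
    sumTo (λ i → gauss M i ∙ x (suc i)) (suc M) ⊕ sumTo (λ i → gauss M i ∙ (q^ (i ℕ.* c) ∙ x i)) (suc M)
  gauss-sum-suc M x = begin
    𝟙 ∙ x 0 ⊕ sumTo (λ i → gauss (suc M) (suc i) ∙ x (suc i)) (suc M)
      -- The inserted unit `q^ 0` gives the term at 0 the shape of `shifted 0`, so that it can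
      -- rejoin the second sum.
      ≈⟨ +-cong (*-congˡ {𝟙} (≈-sym (*-identityˡ (x 0)))) (sumTo-cong (suc M) split) ⟩
    𝟙 ∙ (q^ 0 ∙ x 0) ⊕ sumTo (λ i → gauss M i ∙ x (suc i) ⊕ shifted (suc i)) (suc M)
      ≈⟨ +-cong (≈-refl {𝟙 ∙ (q^ 0 ∙ x 0)}) (sumTo-⊕ (λ i → gauss M i ∙ x (suc i)) (shifted ∘ suc) (suc M)) ⟩
    𝟙 ∙ (q^ 0 ∙ x 0) ⊕ (sumTo (λ i → gauss M i ∙ x (suc i)) (suc M) ⊕ sumTo (shifted ∘ suc) (suc M))
      ≈⟨ exactly (λ n → ℤ+.x∙yz≈y∙xz ((𝟙 ∙ (q^ 0 ∙ x 0)) n) (sumTo (λ i → gauss M i ∙ x (suc i)) (suc M) n) (sumTo (shifted ∘ suc) (suc M) n)) ⟩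
    sumTo (λ i → gauss M i ∙ x (suc i)) (suc M) ⊕ sumTo shifted (suc (suc M))
      ≈⟨ +-cong (≈-refl {sumTo (λ i → gauss M i ∙ x (suc i)) (suc M)}) (sumTo-last shifted (suc M) last≈𝟘) ⟩
    sumTo (λ i → gauss M i ∙ x (suc i)) (suc M) ⊕ sumTo shifted (suc M) ∎
    where
    open ≈-Reasoning
    shifted : ℕ → Series
    shifted i = gauss M i ∙ (q^ (i ℕ.* c) ∙ x i)

    last≈𝟘 : shifted (suc M) ≈ 𝟘
    last≈𝟘 = ≈-trans (*-congʳ {q^ (suc M ℕ.* c) ∙ x (suc M)} (gauss-> (ℕ.n<1+n M))) (zeroˡ (q^ (suc M ℕ.* c) ∙ x (suc M)))

    split : ∀ i → gauss (suc M) (suc i) ∙ x (suc i) ≈ gauss M i ∙ x (suc i) ⊕ shifted (suc i)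
    split i = ≈-trans (distribʳ (x (suc i)) (gauss M i) (q^ (suc i ℕ.* c) ∙ gauss M (suc i)))
      (+-cong (≈-refl {gauss M i ∙ x (suc i)}) (∙.xy∙z≈y∙xz (q^ (suc i ℕ.* c)) (gauss M (suc i)) (x (suc i))))

  Q-factorial : ℕ → Series
  Q-factorial = partial (λ k → φ⁻ (c ℕ.+ k ℕ.* c))

  -- With x = q^((i+1)c) and y = q^((j+1)c), Pascal's rule reduces the claim to (1 - x) + x(1 - y) =
  -- 1 - xy.
  gauss-factorials : ∀ i j → gauss (i ℕ.+ j) i ∙ (Q-factorial i ∙ Q-factorial j) ≈ Q-factorial (i ℕ.+ j)
  gauss-factorials zero    j    = ≈-trans (*-identityˡ _) (*-identityˡ _)
  gauss-factorials (suc i) zero rewrite ℕ.+-identityʳ i =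
    ≈-trans (*-cong (gauss-diagonal (suc i)) (*-identityʳ (Q-factorial (suc i)))) (*-identityˡ _)
  gauss-factorials (suc i) (suc j) = begin
    (G₁ ⊕ x ∙ G₂) ∙ ((A ∙ Qᵢ) ∙ (B ∙ Qⱼ))
      ≈⟨ distribʳ _ G₁ (x ∙ G₂) ⟩
    G₁ ∙ ((A ∙ Qᵢ) ∙ (B ∙ Qⱼ)) ⊕ (x ∙ G₂) ∙ ((A ∙ Qᵢ) ∙ (B ∙ Qⱼ))
      ≈⟨ +-cong (collect₁ G₁ A Qᵢ B Qⱼ) (collect₂ x G₂ A Qᵢ B Qⱼ) ⟩
    A ∙ (G₁ ∙ (Qᵢ ∙ (B ∙ Qⱼ))) ⊕ (x ∙ B) ∙ (G₂ ∙ ((A ∙ Qᵢ) ∙ Qⱼ))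
      ≈⟨ +-cong (*-congˡ {A} (gauss-factorials i (suc j))) (*-congˡ {x ∙ B} second) ⟩
    A ∙ Qᵢⱼ ⊕ (x ∙ B) ∙ Qᵢⱼ
      ≈⟨ distribʳ Qᵢⱼ A (x ∙ B) ⟨
    (A ⊕ x ∙ B) ∙ Qᵢⱼ
      ≈⟨ *-congʳ {Qᵢⱼ} factor ⟩
    φ⁻ (c ℕ.+ (i ℕ.+ suc j) ℕ.* c) ∙ Qᵢⱼ ∎
    where
    open ≈-Reasoning
    G₁ G₂ x A B Qᵢ Qⱼ Qᵢⱼ : Series
    G₁ = gauss (i ℕ.+ suc j) i
    G₂ = gauss (i ℕ.+ suc j) (suc i)
    x = q^ (suc i ℕ.* c)
    A = φ⁻ (c ℕ.+ i ℕ.* c)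
    B = φ⁻ (c ℕ.+ j ℕ.* c)
    Qᵢ = Q-factorial i
    Qⱼ = Q-factorial j
    Qᵢⱼ = Q-factorial (i ℕ.+ suc j)

    second : G₂ ∙ ((A ∙ Qᵢ) ∙ Qⱼ) ≈ Qᵢⱼ
    second rewrite ℕ.+-suc i j = gauss-factorials (suc i) j

    factor : A ⊕ x ∙ B ≈ φ⁻ (c ℕ.+ (i ℕ.+ suc j) ℕ.* c)
    factor = begin
      A ⊕ x ∙ B                                    ≈⟨ +-cong (≈-refl {A}) (x[y-z]≈xy-xz x 𝟙 (q^ (suc j ℕ.* c))) ⟩
      A ⊕ ((x ∙ 𝟙) ⊖ (x ∙ q^ (suc j ℕ.* c)))       ≈⟨ exactly (λ n → cong₂ (λ y z → A n + (y + - z)) (coeff (*-identityʳ x) n) (coeff (q^-+ (suc i ℕ.* c) (suc j ℕ.* c)) n)) ⟩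
      (𝟙 ⊖ x) ⊕ (x ⊖ q^ (suc i ℕ.* c ℕ.+ suc j ℕ.* c)) ≈⟨ exactly (λ n → telescope (𝟙 n) (x n) _) ⟩
      φ⁻ (suc i ℕ.* c ℕ.+ suc j ℕ.* c)              ≈⟨ ≈-reflexive (cong φ⁻ (sym (ℕ.*-distribʳ-+ c (suc i) (suc j)))) ⟩
      φ⁻ ((suc i ℕ.+ suc j) ℕ.* c)                  ∎
      where
      telescope : ∀ p r s → (p + - r) + (r + - s) ≡ p + - s
      telescope = ℤSolver.solve-∀

  Q∞ : Series
  Q∞ = ⟨ c ⨾ c ⟩⁻

  -- Multiply by one more `Q∞`. Modulo `q^(k+1)` the two copies of `Q∞` may be replaced by the
  -- factorials of i and j, and the product formula returns the factorial of i + j, which is again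
  -- `Q∞` to this order.
  gauss-limit : ∀ {k i j} .{{_ : NonZero c}} → k ℕ.≤ i → k ℕ.≤ j → gauss (i ℕ.+ j) i ∙ Q∞ ≈[ suc k ] 𝟙
  gauss-limit {k} {i} {j} k≤i k≤j = ∙-cancelˡ[] Q∞ refl (begin
    Q∞ ∙ (gauss (i ℕ.+ j) i ∙ Q∞)                      ≈⟨ truncate (∙.x∙yz≈y∙xz Q∞ (gauss (i ℕ.+ j) i) Q∞) ⟩
    gauss (i ℕ.+ j) i ∙ (Q∞ ∙ Q∞)                      ≈⟨ ∙-cong[] (≈[]-refl {u = gauss (i ℕ.+ j) i}) (∙-cong[] (limit k≤i) (limit k≤j)) ⟩
    gauss (i ℕ.+ j) i ∙ (Q-factorial i ∙ Q-factorial j) ≈⟨ truncate (gauss-factorials i j) ⟩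
    Q-factorial (i ℕ.+ j)                              ≈⟨ limit (ℕ.≤-trans k≤i (ℕ.m≤m+n i j)) ⟨
    Q∞                                                 ≈⟨ truncate (*-identityʳ Q∞) ⟨
    Q∞ ∙ 𝟙                                             ∎)
    where
    open ≈[]-Reasoning (suc k)
    limit : ∀ {m} → k ℕ.≤ m → Q∞ ≈[ suc k ] Q-factorial m
    limit = Π-partial (progression-convergent φ⁻ c c)

  -- The sum of the i terms a, a + c, a + 2c, ..., that is c i(i-1)/2 + a i without a division.
  -- Moving the start to `a + c` mirrors the removal of the first factor of a product.
  ramp : ℕ → ℕ → ℕ
  ramp a zero    = 0
  ramp a (suc i) = a ℕ.+ ramp (a ℕ.+ c) i

  ramp-shift : ∀ a i → i ℕ.* c ℕ.+ ramp a i ≡ ramp (a ℕ.+ c) i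
  ramp-shift a zero    = refl
  ramp-shift a (suc i) = trans (regroup a c (i ℕ.* c) (ramp (a ℕ.+ c) i)) (cong (a ℕ.+ c ℕ.+_) (ramp-shift (a ℕ.+ c) i))
    where
    regroup : ∀ a c m r → (c ℕ.+ m) ℕ.+ (a ℕ.+ r) ≡ a ℕ.+ c ℕ.+ (m ℕ.+ r)
    regroup = ℕSolver.solve-∀

  ramp-suc : ∀ a i → ramp a (suc i) ≡ a ℕ.+ (i ℕ.* c ℕ.+ ramp a i)
  ramp-suc a i = cong (a ℕ.+_) (sym (ramp-shift a i))

  ramp-≥ : ∀ a .{{_ : NonZero a}} i → i ℕ.≤ ramp a i
  ramp-≥ a@(suc _)  zero    = z≤n
  ramp-≥ a@(suc a-1) (suc i) = s≤s (ℕ.≤-trans (ramp-≥ (a ℕ.+ c) i) (ℕ.m≤n+m _ a-1))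

  -- Induction removes the first factor 1 + q^a, leaving a product that starts at a + c. A ramp from
  -- a + c gains a term in front when multiplied by q^a, and otherwise equals `i * c` plus the ramp
  -- from a: these are the two sums of Pascal's rule.
  q-binomial : ∀ a m → partial (λ k → φ⁺ (a ℕ.+ k ℕ.* c)) m ≈ sumTo (λ i → gauss m i ∙ q^ ramp a i) (suc m)
  q-binomial a zero    = exactly λ n → sym (trans (ℤ.+-identityʳ _) (coeff (*-identityˡ 𝟙) n))
  q-binomial a (suc m) = begin
    partial (λ k → φ⁺ (a ℕ.+ k ℕ.* c)) (suc m)
      ≈⟨ partial-front (λ k → φ⁺ (a ℕ.+ k ℕ.* c)) m ⟩
    φ⁺ (a ℕ.+ 0) ∙ partial (λ k → φ⁺ (a ℕ.+ suc k ℕ.* c)) m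
      ≈⟨ *-cong (≈-reflexive (cong φ⁺ (ℕ.+-identityʳ a))) (partial-cong (λ k → ≈-reflexive (cong φ⁺ (sym (ℕ.+-assoc a c (k ℕ.* c))))) m) ⟩
    φ⁺ a ∙ partial (λ k → φ⁺ (a ℕ.+ c ℕ.+ k ℕ.* c)) m
      ≈⟨ *-congˡ {φ⁺ a} (q-binomial (a ℕ.+ c) m) ⟩
    φ⁺ a ∙ S
      ≈⟨ φ⁺-∙ a S ⟩
    q^ a ∙ S ⊕ S
      ≈⟨ +-cong (≈-trans (sumTo-∙ (q^ a) (λ i → gauss m i ∙ q^ ramp (a ℕ.+ c) i) (suc m)) (sumTo-cong (suc m) up)) (sumTo-cong (suc m) down) ⟩
    sumTo (λ i → gauss m i ∙ q^ ramp a (suc i)) (suc m) ⊕ sumTo (λ i → gauss m i ∙ (q^ (i ℕ.* c) ∙ q^ ramp a i)) (suc m)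
      ≈⟨ gauss-sum-suc m (λ i → q^ ramp a i) ⟨
    sumTo (λ i → gauss (suc m) i ∙ q^ ramp a i) (suc (suc m)) ∎
    where
    open ≈-Reasoning
    S : Series
    S = sumTo (λ i → gauss m i ∙ q^ ramp (a ℕ.+ c) i) (suc m)

    up : ∀ i → q^ a ∙ (gauss m i ∙ q^ ramp (a ℕ.+ c) i) ≈ gauss m i ∙ q^ ramp a (suc i)
    up i = ≈-trans (∙.x∙yz≈y∙xz (q^ a) (gauss m i) _) (*-congˡ {gauss m i} (q^-+ a (ramp (a ℕ.+ c) i)))

    down : ∀ i → gauss m i ∙ q^ ramp (a ℕ.+ c) i ≈ gauss m i ∙ (q^ (i ℕ.* c) ∙ q^ ramp a i)
    down i = *-congˡ {gauss m i} (≈-sym (≈-trans (q^-+ (i ℕ.* c) (ramp a i)) (≈-reflexive (cong q^_ (ramp-shift a i)))))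

open Gaussian

-- Jacobi's triple product

-- The exponent c j(j-1)/2 + a j, where c = a + b, of the theta series of (a, b).
exponent : ℕ → ℕ → ℤ → ℕ
exponent a b (+ i)    = ramp (a ℕ.+ b) a i
exponent a b -[1+ i ] = ramp (a ℕ.+ b) b (suc i)

exponent-0⊖ : ∀ a b k → exponent a b (0 ℤ.⊖ k) ≡ ramp (a ℕ.+ b) b k
exponent-0⊖ a b zero    = refl
exponent-0⊖ a b (suc k) = refl

-- With c = a + b, e(j) the exponent and j = i - n, this is e(j) - e(j-1) = cj - b, with all terms
-- moved to where they are added.
exponent-⊖-suc : ∀ a b i n → i ℕ.* (a ℕ.+ b) ℕ.+ exponent a b (i ℤ.⊖ suc n) ≡
                             (b ℕ.+ n ℕ.* (a ℕ.+ b)) ℕ.+ exponent a b (i ℤ.⊖ n)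
exponent-⊖-suc a b zero    n rewrite exponent-0⊖ a b n = trans (ramp-suc (a ℕ.+ b) b n) (sym (ℕ.+-assoc b _ _))
exponent-⊖-suc a b (suc i) zero rewrite ℤ.[1+m]⊖[1+n]≡m⊖n i 0 =
  trans (regroup a b (i ℕ.* (a ℕ.+ b)) _) (cong (b ℕ.+ 0 ℕ.+_) (sym (ramp-suc (a ℕ.+ b) a i)))
  where
  regroup : ∀ a b m r → (a ℕ.+ b) ℕ.+ m ℕ.+ r ≡ b ℕ.+ 0 ℕ.+ (a ℕ.+ (m ℕ.+ r))
  regroup = ℕSolver.solve-∀
exponent-⊖-suc a b (suc i) (suc n) rewrite ℤ.[1+m]⊖[1+n]≡m⊖n i (suc n) | ℤ.[1+m]⊖[1+n]≡m⊖n i n =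
  trans (ℕ.+-assoc (a ℕ.+ b) _ _) (trans (cong (a ℕ.+ b ℕ.+_) (exponent-⊖-suc a b i n)) (regroup (a ℕ.+ b) b _ _))
  where
  regroup : ∀ c b m r → c ℕ.+ (b ℕ.+ m ℕ.+ r) ≡ (b ℕ.+ (c ℕ.+ m)) ℕ.+ r
  regroup = ℕSolver.solve-∀

-- This bound and the next express that the exponent at j is at least |j|, without subtraction; they
-- control the precision in `jacobi`.
exponent-⊖-≥ˡ : ∀ a b .{{_ : NonZero a}} i n → i ℕ.≤ n ℕ.+ exponent a b (i ℤ.⊖ n)
exponent-⊖-≥ˡ a b zero    n       = z≤n
exponent-⊖-≥ˡ a b (suc i) zero    = ramp-≥ (a ℕ.+ b) a (suc i)
exponent-⊖-≥ˡ a b (suc i) (suc n) rewrite ℤ.[1+m]⊖[1+n]≡m⊖n i n = s≤s (exponent-⊖-≥ˡ a b i n)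

exponent-⊖-≥ʳ : ∀ a b .{{_ : NonZero b}} i n → n ℕ.≤ i ℕ.+ exponent a b (i ℤ.⊖ n)
exponent-⊖-≥ʳ a b i       zero    = z≤n
exponent-⊖-≥ʳ a b zero    (suc n) = ramp-≥ (a ℕ.+ b) b (suc n)
exponent-⊖-≥ʳ a b (suc i) (suc n) rewrite ℤ.[1+m]⊖[1+n]≡m⊖n i n = s≤s (exponent-⊖-≥ʳ a b i n)

-- Induction on n from the q-binomial theorem. Multiplying by 1 + q^d moves the centre from n to n +
-- 1: the untouched copy of the sum is reindexed by `suc i`, and the copy times q^d keeps i and
-- takes the Pascal weight.
finite-jacobi : ∀ a b m n → let c = a ℕ.+ b in
  partial (λ k → φ⁺ (a ℕ.+ k ℕ.* c)) m ∙ partial (λ k → φ⁺ (b ℕ.+ k ℕ.* c)) n ≈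
  sumTo (λ i → gauss c (n ℕ.+ m) i ∙ q^ exponent a b (i ℤ.⊖ n)) (suc (n ℕ.+ m))
finite-jacobi a b m zero    = ≈-trans (*-identityʳ _) (q-binomial (a ℕ.+ b) a m)
finite-jacobi a b m (suc n) = begin
  A ∙ (φ⁺ d ∙ B)    ≈⟨ ∙.x∙yz≈y∙xz A (φ⁺ d) B ⟩
  φ⁺ d ∙ (A ∙ B)    ≈⟨ *-congˡ {φ⁺ d} (finite-jacobi a b m n) ⟩
  φ⁺ d ∙ S          ≈⟨ φ⁺-∙ d S ⟩
  q^ d ∙ S ⊕ S      ≈⟨ exactly (λ k → ℤ.+-comm ((q^ d ∙ S) k) (S k)) ⟩
  S ⊕ q^ d ∙ S      ≈⟨ +-cong (sumTo-cong (suc (n ℕ.+ m)) up)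
                              (≈-trans (sumTo-∙ (q^ d) (λ i → gauss c (n ℕ.+ m) i ∙ q^ exponent a b (i ℤ.⊖ n)) (suc (n ℕ.+ m))) (sumTo-cong (suc (n ℕ.+ m)) down)) ⟩
  sumTo (λ i → gauss c (n ℕ.+ m) i ∙ q^ exponent a b (suc i ℤ.⊖ suc n)) (suc (n ℕ.+ m)) ⊕
  sumTo (λ i → gauss c (n ℕ.+ m) i ∙ (q^ (i ℕ.* c) ∙ q^ exponent a b (i ℤ.⊖ suc n))) (suc (n ℕ.+ m))
                    ≈⟨ gauss-sum-suc c (n ℕ.+ m) (λ i → q^ exponent a b (i ℤ.⊖ suc n)) ⟨
  sumTo (λ i → gauss c (suc n ℕ.+ m) i ∙ q^ exponent a b (i ℤ.⊖ suc n)) (suc (suc n ℕ.+ m)) ∎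
  where
  open ≈-Reasoning
  c d : ℕ
  c = a ℕ.+ b
  d = b ℕ.+ n ℕ.* c
  A B S : Series
  A = partial (λ k → φ⁺ (a ℕ.+ k ℕ.* c)) m
  B = partial (λ k → φ⁺ (b ℕ.+ k ℕ.* c)) n
  S = sumTo (λ i → gauss c (n ℕ.+ m) i ∙ q^ exponent a b (i ℤ.⊖ n)) (suc (n ℕ.+ m))

  up : ∀ i → gauss c (n ℕ.+ m) i ∙ q^ exponent a b (i ℤ.⊖ n) ≈ gauss c (n ℕ.+ m) i ∙ q^ exponent a b (suc i ℤ.⊖ suc n)
  up i = ≈-reflexive (cong (λ j → gauss c (n ℕ.+ m) i ∙ q^ exponent a b j) (sym (ℤ.[1+m]⊖[1+n]≡m⊖n i n)))

  down : ∀ i → q^ d ∙ (gauss c (n ℕ.+ m) i ∙ q^ exponent a b (i ℤ.⊖ n)) ≈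
               gauss c (n ℕ.+ m) i ∙ (q^ (i ℕ.* c) ∙ q^ exponent a b (i ℤ.⊖ suc n))
  down i = ≈-trans (∙.x∙yz≈y∙xz (q^ d) (gauss c (n ℕ.+ m) i) _) (*-congˡ {gauss c (n ℕ.+ m) i}
    (≈-trans (q^-+ d _) (≈-trans (≈-reflexive (cong q^_ (sym (exponent-⊖-suc a b i n)))) (≈-sym (q^-+ (i ℕ.* c) _)))))

window : ℕ → List ℤ
window N = applyUpTo (ℤ._⊖ N) (suc (N ℕ.+ N))

jacobiProduct : ℕ → ℕ → Series
jacobiProduct a b = (⟨ a ⨾ a ℕ.+ b ⟩⁺ ∙ ⟨ b ⨾ a ℕ.+ b ⟩⁺) ∙ ⟨ a ℕ.+ b ⨾ a ℕ.+ b ⟩⁻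

-- The symmetric case m = n = N of the finite identity, multiplied by `Q∞`: each Gaussian
-- coefficient then becomes 1 to the precision that its power of q demands.
jacobi : ∀ a b .{{_ : NonZero a}} .{{_ : NonZero b}} N →
         jacobiProduct a b ≈[ suc N ] ⅀ (window N) (λ j → q^ exponent a b j)
jacobi a@(suc _) b N = begin
  (⟨ a ⨾ c ⟩⁺ ∙ ⟨ b ⨾ c ⟩⁺) ∙ Q∞ c
    ≈⟨ ∙-cong[] (∙-cong[] (Π-partial (progression-convergent φ⁺ c a) (ℕ.≤-refl {N}))
                          (Π-partial (progression-convergent φ⁺ c b) (ℕ.≤-refl {N}))) (≈[]-refl {u = Q∞ c}) ⟩
  (partial (λ k → φ⁺ (a ℕ.+ k ℕ.* c)) N ∙ partial (λ k → φ⁺ (b ℕ.+ k ℕ.* c)) N) ∙ Q∞ c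
    ≈⟨ truncate (≈-trans (*-congʳ {Q∞ c} (finite-jacobi a b N N)) (*-comm _ (Q∞ c))) ⟩
  Q∞ c ∙ sumTo (λ i → gauss c (N ℕ.+ N) i ∙ q^ exponent a b (i ℤ.⊖ N)) (suc (N ℕ.+ N))
    ≈⟨ truncate (sumTo-∙ (Q∞ c) (λ i → gauss c (N ℕ.+ N) i ∙ q^ exponent a b (i ℤ.⊖ N)) (suc (N ℕ.+ N))) ⟩
  sumTo (λ i → Q∞ c ∙ (gauss c (N ℕ.+ N) i ∙ q^ exponent a b (i ℤ.⊖ N))) (suc (N ℕ.+ N))
    ≈⟨ sumTo-cong[] (suc (N ℕ.+ N)) (λ { {i} (s≤s i≤2N) → term i i≤2N }) ⟩
  sumTo (λ i → q^ exponent a b (i ℤ.⊖ N)) (suc (N ℕ.+ N))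
    ≈⟨ truncate (⅀-applyUpTo (ℤ._⊖ N) (suc (N ℕ.+ N)) (λ j → q^ exponent a b j)) ⟨
  ⅀ (window N) (λ j → q^ exponent a b j) ∎
  where
  open ≈[]-Reasoning (suc N)
  c : ℕ
  c = a ℕ.+ b

  -- gauss-limit is only exact to order N - e, and the factor q^e makes up the difference.
  term : ∀ i → i ℕ.≤ N ℕ.+ N →
         Q∞ c ∙ (gauss c (N ℕ.+ N) i ∙ q^ exponent a b (i ℤ.⊖ N)) ≈[ suc N ] q^ exponent a b (i ℤ.⊖ N)
  term i i≤2N with ℕ.m≤n⇒∃[o]m+o≡n i≤2N
  ... | j , i+j≡2N = begin
    Q∞ c ∙ (gauss c (N ℕ.+ N) i ∙ q^ e)       ≈⟨ truncate (∙.x∙yz≈z∙yx (Q∞ c) (gauss c (N ℕ.+ N) i) (q^ e)) ⟩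
    q^ e ∙ (gauss c (N ℕ.+ N) i ∙ Q∞ c)       ≈⟨ truncate (≈-reflexive (cong (λ M → q^ e ∙ (gauss c M i ∙ Q∞ c)) (sym i+j≡2N))) ⟩
    q^ e ∙ (gauss c (i ℕ.+ j) i ∙ Q∞ c)       ≈⟨ shift-cong e precision (gauss-limit c {N ℕ.∸ e} {i} {j} (ℕ.m≤n+o⇒m∸n≤o N e N≤e+i) (ℕ.m≤n+o⇒m∸n≤o N e N≤e+j)) ⟩
    q^ e ∙ 𝟙                                  ≈⟨ truncate (*-identityʳ (q^ e)) ⟩
    q^ e                                      ∎
    where
    e : ℕ
    e = exponent a b (i ℤ.⊖ N)

    -- If e exceeds N, the truncated difference is 0 and the bound still holds; such a term vanishes
    -- to the required order.
    precision : suc N ℕ.≤ e ℕ.+ suc (N ℕ.∸ e)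
    precision = ℕ.≤-trans (s≤s (ℕ.m≤n+m∸n N e)) (ℕ.≤-reflexive (sym (ℕ.+-suc e (N ℕ.∸ e))))

    N≤e+i : N ℕ.≤ e ℕ.+ i
    N≤e+i = subst (N ℕ.≤_) (ℕ.+-comm i e) (exponent-⊖-≥ʳ a b i N)

    N≤e+j : N ℕ.≤ e ℕ.+ j
    N≤e+j = ℕ.+-cancelˡ-≤ N N (e ℕ.+ j) (ℕ.≤-trans (ℕ.≤-reflexive (sym i+j≡2N))
      (ℕ.≤-trans (ℕ.+-monoˡ-≤ j (exponent-⊖-≥ˡ a b i N)) (ℕ.≤-reflexive (ℕ.+-assoc N e j))))

-- The dissection of the theta product

⅀-cong : ∀ {A : Set} (xs : List A) {g h} → (∀ x → g x ≈ h x) → ⅀ xs g ≈ ⅀ xs h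
⅀-cong []       p = ≈-refl
⅀-cong (x ∷ xs) p = +-cong (p x) (⅀-cong xs p)

⅀-++ : ∀ {A : Set} (xs ys : List A) g → ⅀ (xs ++ ys) g ≈ ⅀ xs g ⊕ ⅀ ys g
⅀-++ []       ys g = exactly λ n → sym (ℤ.+-identityˡ (⅀ ys g n))
⅀-++ (x ∷ xs) ys g = ≈-trans (+-cong (≈-refl {g x}) (⅀-++ xs ys g))
  (exactly λ n → sym (ℤ.+-assoc (g x n) (⅀ xs g n) (⅀ ys g n)))

⅀-map : ∀ {A B : Set} (h : A → B) xs g → ⅀ (map h xs) g ≈ ⅀ xs (g ∘ h)
⅀-map h []       g = ≈-refl
⅀-map h (x ∷ xs) g = +-cong (≈-refl {g (h x)}) (⅀-map h xs g)

⅀-∙ : ∀ {A : Set} w (xs : List A) g → w ∙ ⅀ xs g ≈ ⅀ xs (λ x → w ∙ g x)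
⅀-∙ w []       g = zeroʳ w
⅀-∙ w (x ∷ xs) g = ≈-trans (distribˡ w (g x) (⅀ xs g)) (+-cong (≈-refl {w ∙ g x}) (⅀-∙ w xs g))

⅀-cartesianProduct : ∀ {A B : Set} (xs : List A) (ys : List B) g h →
  ⅀ xs g ∙ ⅀ ys h ≈ ⅀ (cartesianProduct xs ys) (λ (x , y) → g x ∙ h y)
⅀-cartesianProduct []       ys g h = zeroˡ (⅀ ys h)
⅀-cartesianProduct (x ∷ xs) ys g h = begin
  (g x ⊕ ⅀ xs g) ∙ ⅀ ys h
    ≈⟨ distribʳ (⅀ ys h) (g x) (⅀ xs g) ⟩
  g x ∙ ⅀ ys h ⊕ ⅀ xs g ∙ ⅀ ys h
    ≈⟨ +-cong (≈-trans (⅀-∙ (g x) ys h) (≈-sym (⅀-map (x ,_) ys pairs))) (⅀-cartesianProduct xs ys g h) ⟩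
  ⅀ (map (x ,_) ys) pairs ⊕ ⅀ (cartesianProduct xs ys) pairs
    ≈⟨ ⅀-++ (map (x ,_) ys) (cartesianProduct xs ys) pairs ⟨
  ⅀ (cartesianProduct (x ∷ xs) ys) pairs ∎
  where
  open ≈-Reasoning
  pairs : _ × _ → Series
  pairs (x , y) = g x ∙ h y

⅀-↭ : ∀ {A : Set} {xs ys : List A} g → xs ↭ ys → ⅀ xs g ≈ ⅀ ys g
⅀-↭ g Perm.refl          = ≈-refl
⅀-↭ g (Perm.prep x p)    = +-cong (≈-refl {g x}) (⅀-↭ g p)
⅀-↭ g (Perm.swap x y p)  = exactly λ n →
  trans (cong (λ s → g x n + (g y n + s)) (coeff (⅀-↭ g p) n)) (ℤ+.x∙yz≈y∙xz (g x n) (g y n) _)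
⅀-↭ g (Perm.trans p q)   = ≈-trans (⅀-↭ g p) (⅀-↭ g q)

module _ {A : Set} (E : A → ℕ) (N : ℕ) where

  private
    relevant? = λ x → E x ℕ.<? N

  ⅀-filter : ∀ xs → ⅀ xs (λ x → q^ E x) ≈[ N ] ⅀ (filter relevant? xs) (λ x → q^ E x)
  ⅀-filter []       = ≈[]-refl
  ⅀-filter (x ∷ xs) with E x ℕ.<? N
  ... | yes x<N rewrite filter-accept relevant? {xs = xs} x<N = ⊕-cong[] (≈[]-refl {u = q^ E x}) (⅀-filter xs)
  ... | no  x≮N rewrite filter-reject relevant? {xs = xs} x≮N =
    ≈[]-trans (⊕-cong[] (weaken (ℕ.≮⇒≥ x≮N) (q^-below (E x))) (⅀-filter xs))
              (truncate (exactly λ n → ℤ.+-identityˡ _))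

  -- Points of exponent at least N contribute nothing modulo `q^N`. What survives the filter is the
  -- same set in both lists, and two duplicate-free lists with the same elements are permutations of
  -- each other.
  ⅀-reorder : ∀ {xs ys} → Unique xs → Unique ys →
              (∀ {x} → E x ℕ.< N → x ∈ xs) → (∀ {x} → E x ℕ.< N → x ∈ ys) →
              ⅀ xs (λ x → q^ E x) ≈[ N ] ⅀ ys (λ x → q^ E x)
  ⅀-reorder {xs} {ys} xs! ys! xs-complete ys-complete =
    ≈[]-trans (⅀-filter xs) (≈[]-trans (truncate (⅀-↭ (λ x → q^ E x) same)) (≈[]-sym (⅀-filter ys)))
    where
    same : filter relevant? xs ↭ filter relevant? ys
    same = ∼bag⇒↭ (unique∧set⇒bag (Unique.filter⁺ relevant? xs!) (Unique.filter⁺ relevant? ys!)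
      (mk⇔ (λ x∈ → let _ , Ex<N = ∈-filter⁻ relevant? {xs = xs} x∈ in ∈-filter⁺ relevant? (ys-complete Ex<N) Ex<N)
           (λ x∈ → let _ , Ex<N = ∈-filter⁻ relevant? {xs = ys} x∈ in ∈-filter⁺ relevant? (xs-complete Ex<N) Ex<N)))

window-unique : ∀ N → Unique (window N)
window-unique N = Unique.applyUpTo⁺₁ (ℤ._⊖ N) _ λ i<j _ → ℤ.<⇒≢ (ℤ.⊖-monoˡ-< N i<j)

∈-window : ∀ {N} j → ℤ.∣ j ∣ ℕ.≤ N → j ∈ window N
∈-window {N} (+ i) i≤N = subst (_∈ window N)
  (trans (cong (N ℕ.+ i ℤ.⊖_) (sym (ℕ.+-identityʳ N))) (ℤ.+-cancelˡ-⊖ N i 0))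
  (∈-applyUpTo⁺ (ℤ._⊖ N) (s≤s (ℕ.+-monoʳ-≤ N i≤N)))
∈-window {N} -[1+ i ] 1+i≤N with o , refl ← ℕ.m≤n⇒∃[o]m+o≡n 1+i≤N = subst (_∈ window N)
  (trans (cong₂ ℤ._⊖_ (sym (ℕ.+-identityʳ o)) (ℕ.+-comm (suc i) o)) (ℤ.+-cancelˡ-⊖ o 0 (suc i)))
  (∈-applyUpTo⁺ (ℤ._⊖ N) (s≤s (ℕ.≤-trans (ℕ.m≤n+m o (suc i)) (ℕ.m≤m+n N N))))

exponent-≥ : ∀ a b .{{_ : NonZero a}} .{{_ : NonZero b}} j → ℤ.∣ j ∣ ℕ.≤ exponent a b j
exponent-≥ a b (+ i)    = ramp-≥ (a ℕ.+ b) a i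
exponent-≥ a b -[1+ i ] = ramp-≥ (a ℕ.+ b) b (suc i)

-- Doubling avoids the half in c i(i-1)/2, and ℤ is needed because 2a - c may be negative.
ramp-closed : ∀ c a i → + (ramp c a i ℕ.+ ramp c a i) ≡ + c * (+ i * + i) + (+ a + + a - + c) * + i
ramp-closed c a zero    = go (+ c) (+ a)
  where
  go : ∀ c a → + 0 ≡ c * (+ 0 * + 0) + (a + a - c) * + 0
  go = ℤSolver.solve-∀
ramp-closed c a (suc i) = begin
  + (ramp c a (suc i) ℕ.+ ramp c a (suc i))
    ≡⟨ cong +_ (trans (cong (λ r → r ℕ.+ r) (ramp-suc c a i)) (regroup a (i ℕ.* c) (ramp c a i))) ⟩
  + a + + a + (+ (i ℕ.* c) + + (i ℕ.* c)) + + (ramp c a i ℕ.+ ramp c a i)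
    ≡⟨ cong₂ (λ x y → + a + + a + (x + x) + y) (ℤ.pos-* i c) (ramp-closed c a i) ⟩
  + a + + a + (+ i * + c + + i * + c) + (+ c * (+ i * + i) + (+ a + + a - + c) * + i)
    ≡⟨ go (+ c) (+ a) (+ i) ⟩
  + c * ((+ 1 + + i) * (+ 1 + + i)) + (+ a + + a - + c) * (+ 1 + + i) ∎
  where
  open ≡-Reasoning
  regroup : ∀ a m r → (a ℕ.+ (m ℕ.+ r)) ℕ.+ (a ℕ.+ (m ℕ.+ r)) ≡ a ℕ.+ a ℕ.+ (m ℕ.+ m) ℕ.+ (r ℕ.+ r)
  regroup = ℕSolver.solve-∀
  go : ∀ c a i → a + a + (i * c + i * c) + (c * (i * i) + (a + a - c) * i) ≡
                 c * ((+ 1 + i) * (+ 1 + i)) + (a + a - c) * (+ 1 + i)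
  go = ℤSolver.solve-∀

-- Exchanging a and b amounts to replacing j by -j, so one quadratic covers both signs and the ring
-- solver can compare exponents.
exponent-closed : ∀ a b j → + (exponent a b j ℕ.+ exponent a b j) ≡ + (a ℕ.+ b) * (j * j) + (+ a - + b) * j
exponent-closed a b (+ i)    = trans (ramp-closed (a ℕ.+ b) a i) (go (+ a) (+ b) (+ i))
  where
  go : ∀ a b i → (a + b) * (i * i) + (a + a - (a + b)) * i ≡ (a + b) * (i * i) + (a - b) * i
  go = ℤSolver.solve-∀
exponent-closed a b -[1+ i ] = trans (ramp-closed (a ℕ.+ b) b (suc i)) (go (+ a) (+ b) (+ suc i))
  where
  go : ∀ a b i → (a + b) * (i * i) + (b + b - (a + b)) * i ≡ (a + b) * (- i * - i) + (a - b) * - i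
  go = ℤSolver.solve-∀

half-injective : ∀ {i j : ℤ} → i + i ≡ j + j → i ≡ j
half-injective {i} {j} p = ℤ.*-cancelˡ-≡ (+ 2) i j (trans (double i) (trans p (sym (double j))))
  where
  double : ∀ i → + 2 * i ≡ i + i
  double = ℤSolver.solve-∀

double≢1 : ∀ i → i + i ≢ 1ℤ
-- The missing cases compute to an absurdity: twice 0 is 0, and twice a negative number is negative.
double≢1 (+ suc k) p with () ← trans (sym (ℕ.+-suc k k)) (ℕ.suc-injective (ℤ.+-injective p))

-- The odd case is written 2r - 1 because the coordinates of `turn 1ℤ (r , s)` add up to that.
even∨odd : ∀ t → (∃ λ r → t ≡ r + r) ⊎ (∃ λ r → t ≡ r + r - 1ℤ)
even∨odd t with t %ℕ 2 | a≡a%ℕn+[a/ℕn]*n t 2 | n%ℕd<d t 2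
... | 0           | eq | _ = inj₁ (t /ℕ 2 , trans eq (go (t /ℕ 2)))
  where
  go : ∀ k → + 0 + k * + 2 ≡ k + k
  go = ℤSolver.solve-∀
... | 1           | eq | _ = inj₂ (t /ℕ 2 + 1ℤ , trans eq (go (t /ℕ 2)))
  where
  go : ∀ k → + 1 + k * + 2 ≡ (k + 1ℤ) + (k + 1ℤ) - 1ℤ
  go = ℤSolver.solve-∀
... | suc (suc _) | _  | s≤s (s≤s ())

-- The range of turn 0ℤ is the set of (m , n) with m + n even, that of turn 1ℤ the set with m + n odd.
turn : ℤ → ℤ × ℤ → ℤ × ℤ
turn δ (r , s) = r + s - δ , r - s

turn-sum : ∀ δ r s → r + r ≡ (r + s - δ) + (r - s) + δ
turn-sum = ℤSolver.solve-∀

turn-difference : ∀ δ r s → s + s ≡ (r + s - δ) - (r - s) + δ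
turn-difference = ℤSolver.solve-∀

turn-injective : ∀ δ {x y} → turn δ x ≡ turn δ y → x ≡ y
turn-injective δ {r , s} {r′ , s′} p = cong₂ _,_
  (half-injective (trans (turn-sum δ r s) (trans (cong (λ (m , n) → m + n + δ) p) (sym (turn-sum δ r′ s′)))))
  (half-injective (trans (turn-difference δ r s) (trans (cong (λ (m , n) → m - n + δ) p) (sym (turn-difference δ r′ s′)))))

-- The coordinate sums are 2r and 2r′ - 1; were they equal, 1 would be a double.
turn-disjoint : ∀ x y → turn 0ℤ x ≢ turn 1ℤ y
turn-disjoint (r , s) (r′ , s′) p = double≢1 (r′ - r) (begin
  (r′ - r) + (r′ - r)        ≡⟨ regroup r r′ ⟩
  (r′ + r′) - (r + r)        ≡⟨ cong₂ _-_ (turn-sum 1ℤ r′ s′) (trans (turn-sum 0ℤ r s) (cong (λ (m , n) → m + n + 0ℤ) p)) ⟩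
  ((r′ + s′ - 1ℤ) + (r′ - s′) + 1ℤ) - ((r′ + s′ - 1ℤ) + (r′ - s′) + 0ℤ) ≡⟨ cancel ((r′ + s′ - 1ℤ) + (r′ - s′)) ⟩
  1ℤ                         ∎)
  where
  open ≡-Reasoning
  regroup : ∀ r r′ → (r′ - r) + (r′ - r) ≡ (r′ + r′) - (r + r)
  regroup = ℤSolver.solve-∀
  cancel : ∀ i → (i + 1ℤ) - (i + 0ℤ) ≡ 1ℤ
  cancel = ℤSolver.solve-∀

turn-surjective : ∀ x → (∃ λ y → x ≡ turn 0ℤ y) ⊎ (∃ λ y → x ≡ turn 1ℤ y)
turn-surjective (m , n) with even∨odd (m + n)
... | inj₁ (r , eq) = inj₁ ((r , m - r) , cong₂ _,_ (go₁ m r) (go₂ m n r eq))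
  where
  go₁ : ∀ m r → m ≡ r + (m - r) - 0ℤ
  go₁ = ℤSolver.solve-∀
  go₂ : ∀ m n r → m + n ≡ r + r → n ≡ r - (m - r)
  go₂ m n r eq = trans (to m n) (trans (cong (_- m) eq) (from m r))
    where
    to : ∀ m n → n ≡ m + n - m
    to = ℤSolver.solve-∀
    from : ∀ m r → r + r - m ≡ r - (m - r)
    from = ℤSolver.solve-∀
... | inj₂ (r , eq) = inj₂ ((r , m - r + 1ℤ) , cong₂ _,_ (go₁ m r) (go₂ m n r eq))
  where
  go₁ : ∀ m r → m ≡ r + (m - r + 1ℤ) - 1ℤ
  go₁ = ℤSolver.solve-∀
  go₂ : ∀ m n r → m + n ≡ r + r - 1ℤ → n ≡ r - (m - r + 1ℤ)
  go₂ m n r eq = trans (to m n) (trans (cong (_- m) eq) (from m r))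
    where
    to : ∀ m n → n ≡ m + n - m
    to = ℤSolver.solve-∀
    from : ∀ m r → r + r - 1ℤ - m ≡ r - (m - r + 1ℤ)
    from = ℤSolver.solve-∀

pairExponent : ℤ × ℤ → ℕ
pairExponent (m , n) = exponent 9 1 m ℕ.+ exponent 7 3 n

+double-injective : ∀ {m n : ℕ} → + (m ℕ.+ m) ≡ + (n ℕ.+ n) → m ≡ n
+double-injective {m} {n} p = ℤ.+-injective (half-injective {+ m} {+ n} p)

exponents-double : ∀ a b a′ b′ j j′ →
  + ((exponent a b j ℕ.+ exponent a′ b′ j′) ℕ.+ (exponent a b j ℕ.+ exponent a′ b′ j′)) ≡
  (+ (a ℕ.+ b) * (j * j) + (+ a - + b) * j) + (+ (a′ ℕ.+ b′) * (j′ * j′) + (+ a′ - + b′) * j′)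
exponents-double a b a′ b′ j j′ = trans (cong +_ (regroup (exponent a b j) (exponent a′ b′ j′)))
  (cong₂ _+_ (exponent-closed a b j) (exponent-closed a′ b′ j′))
  where
  regroup : ∀ m n → (m ℕ.+ n) ℕ.+ (m ℕ.+ n) ≡ (m ℕ.+ m) ℕ.+ (n ℕ.+ n)
  regroup = ℕSolver.solve-∀

-- The doubled linear part 8m + 4n becomes 12r + 4s, and the new pairs are those with sum 20 and
-- differences 12 and 4.
pairExponent-even : ∀ r s → pairExponent (turn 0ℤ (r , s)) ≡ exponent 16 4 r ℕ.+ exponent 12 8 s
pairExponent-even r s = +double-injective (trans (exponents-double 9 1 7 3 (r + s - 0ℤ) (r - s))
  (trans (go r s) (sym (exponents-double 16 4 12 8 r s))))
  where
  go : ∀ r s → (+ 10 * ((r + s - 0ℤ) * (r + s - 0ℤ)) + + 8 * (r + s - 0ℤ)) + (+ 10 * ((r - s) * (r - s)) + + 4 * (r - s)) ≡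
               (+ 20 * (r * r) + + 12 * r) + (+ 20 * (s * s) + + 4 * s)
  go = ℤSolver.solve-∀

-- The origin is sent to (m, n) = (-1, 0), of exponent 1, which is the source of the extra factor q.
-- The doubled linear part is -8r - 16s, whence the differences 6 - 14 and 2 - 18.
pairExponent-odd : ∀ r s → pairExponent (turn 1ℤ (r , s)) ≡ 1 ℕ.+ (exponent 6 14 r ℕ.+ exponent 2 18 s)
pairExponent-odd r s = +double-injective (trans (exponents-double 9 1 7 3 (r + s - 1ℤ) (r - s))
  (trans (go r s) (trans (cong (λ x → + 2 + x) (sym (exponents-double 6 14 2 18 r s)))
    (cong +_ (regroup (exponent 6 14 r ℕ.+ exponent 2 18 s))))))
  where
  regroup : ∀ m → 2 ℕ.+ (m ℕ.+ m) ≡ (1 ℕ.+ m) ℕ.+ (1 ℕ.+ m)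
  regroup = ℕSolver.solve-∀
  go : ∀ r s → (+ 10 * ((r + s - 1ℤ) * (r + s - 1ℤ)) + + 8 * (r + s - 1ℤ)) + (+ 10 * ((r - s) * (r - s)) + + 4 * (r - s)) ≡
               + 2 + ((+ 20 * (r * r) + -[1+ 7 ] * r) + (+ 20 * (s * s) + -[1+ 15 ] * s))
  go = ℤSolver.solve-∀

box : ℕ → List (ℤ × ℤ)
box N = cartesianProduct (window N) (window N)

box-unique : ∀ N → Unique (box N)
box-unique N = Unique.cartesianProduct⁺ (window-unique N) (window-unique N)

∈-box : ∀ a b a′ b′ .{{_ : NonZero a}} .{{_ : NonZero b}} .{{_ : NonZero a′}} .{{_ : NonZero b′}} {N} r s →
        exponent a b r ℕ.+ exponent a′ b′ s ℕ.≤ N → (r , s) ∈ box N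
∈-box a b a′ b′ r s p = ∈-cartesianProduct⁺
  (∈-window r (ℕ.≤-trans (exponent-≥ a b r) (ℕ.m+n≤o⇒m≤o (exponent a b r) p)))
  (∈-window s (ℕ.≤-trans (exponent-≥ a′ b′ s) (ℕ.m+n≤o⇒n≤o (exponent a b r) p)))

jacobi-product : ∀ a b a′ b′ .{{_ : NonZero a}} .{{_ : NonZero b}} .{{_ : NonZero a′}} .{{_ : NonZero b′}} N →
  jacobiProduct a b ∙ jacobiProduct a′ b′ ≈[ suc N ] ⅀ (box N) (λ (r , s) → q^ (exponent a b r ℕ.+ exponent a′ b′ s))
jacobi-product a b a′ b′ N = ≈[]-trans (∙-cong[] (jacobi a b N) (jacobi a′ b′ N))
  (truncate (≈-trans (⅀-cartesianProduct (window N) (window N) (λ j → q^ exponent a b j) (λ j → q^ exponent a′ b′ j))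
                     (⅀-cong (box N) λ (r , s) → q^-+ (exponent a b r) (exponent a′ b′ s))))

-- A box and the turned copies of it cover different regions of the lattice. They need only share
-- the points of exponent at most N, and each contains all of those.
theta-dissection : jacobiProduct 9 1 ∙ jacobiProduct 7 3 ≈
             jacobiProduct 16 4 ∙ jacobiProduct 12 8 ⊕ q^ 1 ∙ (jacobiProduct 6 14 ∙ jacobiProduct 2 18)
theta-dissection = untruncate λ N → let open ≈[]-Reasoning (suc N) in begin
  jacobiProduct 9 1 ∙ jacobiProduct 7 3
    ≈⟨ jacobi-product 9 1 7 3 N ⟩
  ⅀ (box N) (λ x → q^ pairExponent x)
    ≈⟨ ⅀-reorder pairExponent (suc N) (box-unique N) (turned-unique N) (λ { {m , n} (s≤s p) → ∈-box 9 1 7 3 m n p }) (turned-complete N) ⟩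
  ⅀ (map (turn 0ℤ) (box N) ++ map (turn 1ℤ) (box N)) (λ x → q^ pairExponent x)
    ≈⟨ truncate (≈-trans (⅀-++ (map (turn 0ℤ) (box N)) (map (turn 1ℤ) (box N)) (λ x → q^ pairExponent x))
         (+-cong (⅀-map (turn 0ℤ) (box N) (λ x → q^ pairExponent x)) (⅀-map (turn 1ℤ) (box N) (λ x → q^ pairExponent x)))) ⟩
  ⅀ (box N) (λ x → q^ pairExponent (turn 0ℤ x)) ⊕ ⅀ (box N) (λ x → q^ pairExponent (turn 1ℤ x))
    ≈⟨ truncate (+-cong (⅀-cong (box N) λ (r , s) → ≈-reflexive (cong q^_ (pairExponent-even r s)))
         (≈-trans (⅀-cong (box N) λ (r , s) → ≈-trans (≈-reflexive (cong q^_ (pairExponent-odd r s))) (≈-sym (q^-+ 1 _)))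
           (≈-sym (⅀-∙ (q^ 1) (box N) (λ (r , s) → q^ (exponent 6 14 r ℕ.+ exponent 2 18 s)))))) ⟩
  ⅀ (box N) (λ (r , s) → q^ (exponent 16 4 r ℕ.+ exponent 12 8 s)) ⊕
  q^ 1 ∙ ⅀ (box N) (λ (r , s) → q^ (exponent 6 14 r ℕ.+ exponent 2 18 s))
    ≈⟨ ⊕-cong[] (jacobi-product 16 4 12 8 N) (∙-cong[] ≈[]-refl (jacobi-product 6 14 2 18 N)) ⟨
  jacobiProduct 16 4 ∙ jacobiProduct 12 8 ⊕ q^ 1 ∙ (jacobiProduct 6 14 ∙ jacobiProduct 2 18) ∎
  where
  turned-unique : ∀ N → Unique (map (turn 0ℤ) (box N) ++ map (turn 1ℤ) (box N))
  turned-unique N = Unique.++⁺ (Unique.map⁺ (turn-injective 0ℤ) (box-unique N)) (Unique.map⁺ (turn-injective 1ℤ) (box-unique N))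
    λ {v} (x∈ , y∈) → let x , _ , v≡x = ∈-map⁻ (turn 0ℤ) {xs = box N} x∈ ; y , _ , v≡y = ∈-map⁻ (turn 1ℤ) {xs = box N} y∈ in
      turn-disjoint x y (trans {j = v} (sym v≡x) v≡y)

  turned-complete : ∀ N {x} → pairExponent x ℕ.< suc N → x ∈ map (turn 0ℤ) (box N) ++ map (turn 1ℤ) (box N)
  turned-complete N {x} (s≤s p) with turn-surjective x
  ... | inj₁ ((r , s) , refl) = ∈-++⁺ˡ (∈-map⁺ (turn 0ℤ)
        (∈-box 16 4 12 8 r s (subst (ℕ._≤ N) (pairExponent-even r s) p)))
  ... | inj₂ ((r , s) , refl) = ∈-++⁺ʳ (map (turn 0ℤ) (box N)) (∈-map⁺ (turn 1ℤ)
        (∈-box 6 14 2 18 r s (ℕ.≤-trans (ℕ.n≤1+n _) (subst (ℕ._≤ N) (pairExponent-odd r s) p))))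

-- The dissection of the quotient

opaque
  unfolding _∙_
  -- The trailing `𝟙` is what the squares in the definition of `a` unfold to.
  a-cross : a ∙ (f 1 ∙ (f 4 ∙ (f 4 ∙ 𝟙))) ≈ (f 2 ∙ (f 2 ∙ 𝟙)) ∙ f 5
  a-cross = exactly a-defining

-- W = f₂₀ / f₄; see W-quotient.
W-tail W : Series
W-tail = progression geometric 20 8 ∙ (progression geometric 20 12 ∙ progression geometric 20 16)
W = progression geometric 20 4 ∙ W-tail

evenNumerator oddNumerator evenPart oddPart : Series
evenNumerator = (⟨ 16 ⨾ 20 ⟩⁺ ∙ ⟨ 4 ⨾ 20 ⟩⁺) ∙ (⟨ 12 ⨾ 20 ⟩⁺ ∙ ⟨ 8 ⨾ 20 ⟩⁺)
oddNumerator = (⟨ 6 ⨾ 20 ⟩⁺ ∙ ⟨ 14 ⨾ 20 ⟩⁺) ∙ (⟨ 2 ⨾ 20 ⟩⁺ ∙ ⟨ 18 ⨾ 20 ⟩⁺)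
evenPart = evenNumerator ∙ W
oddPart = oddNumerator ∙ W

a-cross-progressions : a ∙ (⟨ 1 ⨾ 1 ⟩⁻ ∙ (⟨ 4 ⨾ 4 ⟩⁻ ∙ (⟨ 4 ⨾ 4 ⟩⁻ ∙ 𝟙))) ≈ (⟨ 2 ⨾ 2 ⟩⁻ ∙ (⟨ 2 ⨾ 2 ⟩⁻ ∙ 𝟙)) ∙ ⟨ 5 ⨾ 5 ⟩⁻
a-cross-progressions = ≈-trans
  (≈-sym (*-congˡ {a} (*-cong (f-progression 1) (*-cong (f-progression 4) (*-congʳ {𝟙} (f-progression 4))))))
  (≈-trans a-cross (*-cong (*-cong (f-progression 2) (*-congʳ {𝟙} (f-progression 2))) (f-progression 5)))

theta-product : ((⟨ 2 ⨾ 2 ⟩⁻ ∙ ⟨ 2 ⨾ 2 ⟩⁻) ∙ ⟨ 5 ⨾ 5 ⟩⁻) ∙ ⟨ 20 ⨾ 20 ⟩⁻ ≈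
                (⟨ 1 ⨾ 1 ⟩⁻ ∙ ⟨ 4 ⨾ 4 ⟩⁻) ∙ (jacobiProduct 9 1 ∙ jacobiProduct 7 3)
theta-product = ∙-cancelˡ (⟨ 2 ⨾ 2 ⟩⁺ ∙ ⟨ 5 ⨾ 5 ⟩⁺) (∙-constant {⟨ 2 ⨾ 2 ⟩⁺} {⟨ 5 ⨾ 5 ⟩⁺} refl refl)
  (eliminate-doubles (progression-double 1 1) (progression-double 2 2) (progression-double 5 5) (progression-double 10 10)
    (≈-trans (*-congʳ {jacobiProduct 9 1 ∙ jacobiProduct 7 3} (*-cong (progression-blocks φ⁺ 2 2 5) (progression-blocks φ⁺ 5 5 2)))
      (≈-trans (odd-residues (p 1) (p 2) (p 3) (p 4) (p 5) (p 6) (p 7) (p 8) (p 9) (p 10) ⟨ 10 ⨾ 10 ⟩⁻)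
        (*-congʳ {⟨ 10 ⨾ 10 ⟩⁻ ∙ ⟨ 10 ⨾ 10 ⟩⁻} (*-congʳ {p 10} (≈-sym (progression-blocks φ⁺ 1 1 10)))))))
  where
  p : ℕ → Series
  p r = ⟨ r ⨾ 10 ⟩⁺

-- The multiples of 4 fall into the classes 4, 8, 12, 16, 20 modulo 20, and `W` inverts the first
-- four.
W-quotient : W ∙ ⟨ 4 ⨾ 4 ⟩⁻ ≈ ⟨ 20 ⨾ 20 ⟩⁻
W-quotient = ≈-trans (*-congˡ {W} (progression-blocks φ⁻ 4 4 5))
  (cancel-geometric ⟨ 20 ⨾ 20 ⟩⁻ (progression-inverse 20 4) (progression-inverse 20 8) (progression-inverse 20 12) (progression-inverse 20 16))

-- Both sides are multiplied by f₁f₄ · f₄f₂₀: f₁f₄² clears the denominator of `a`, while f₄f₂₀ turns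
-- each numerator times `W` into a product of two triple products.
a-dissection : a ≈ evenPart ⊕ q^ 1 ∙ oddPart
a-dissection = ∙-cancelˡ ((F 1 ∙ F 4) ∙ (F 4 ∙ F 20))
  (∙-constant {F 1 ∙ F 4} {F 4 ∙ F 20} (∙-constant {F 1} {F 4} refl refl) (∙-constant {F 4} {F 20} refl refl))
  (begin
    ((F 1 ∙ F 4) ∙ (F 4 ∙ F 20)) ∙ a
      ≈⟨ quotient-cross (F 20) a-cross-progressions ⟩
    ((F 2 ∙ F 2) ∙ F 5) ∙ F 20
      ≈⟨ theta-product ⟩
    (F 1 ∙ F 4) ∙ (jacobiProduct 9 1 ∙ jacobiProduct 7 3)
      ≈⟨ *-congˡ {F 1 ∙ F 4} theta-dissection ⟩
    (F 1 ∙ F 4) ∙ (jacobiProduct 16 4 ∙ jacobiProduct 12 8 ⊕ q^ 1 ∙ (jacobiProduct 6 14 ∙ jacobiProduct 2 18))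
      ≈⟨ *-congˡ {F 1 ∙ F 4} (+-cong (attach (⟨ 16 ⨾ 20 ⟩⁺ ∙ ⟨ 4 ⨾ 20 ⟩⁺) (⟨ 12 ⨾ 20 ⟩⁺ ∙ ⟨ 8 ⨾ 20 ⟩⁺) W-quotient)
           (*-congˡ {q^ 1} (attach (⟨ 6 ⨾ 20 ⟩⁺ ∙ ⟨ 14 ⨾ 20 ⟩⁺) (⟨ 2 ⨾ 20 ⟩⁺ ∙ ⟨ 18 ⨾ 20 ⟩⁺) W-quotient))) ⟨
    (F 1 ∙ F 4) ∙ (evenPart ∙ (F 4 ∙ F 20) ⊕ q^ 1 ∙ (oddPart ∙ (F 4 ∙ F 20)))
      ≈⟨ *-congˡ {F 1 ∙ F 4} (+-cong (≈-refl {evenPart ∙ (F 4 ∙ F 20)}) (*-assoc (q^ 1) oddPart (F 4 ∙ F 20))) ⟨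
    (F 1 ∙ F 4) ∙ (evenPart ∙ (F 4 ∙ F 20) ⊕ (q^ 1 ∙ oddPart) ∙ (F 4 ∙ F 20))
      ≈⟨ *-congˡ {F 1 ∙ F 4} (distribʳ (F 4 ∙ F 20) evenPart (q^ 1 ∙ oddPart)) ⟨
    (F 1 ∙ F 4) ∙ ((evenPart ⊕ q^ 1 ∙ oddPart) ∙ (F 4 ∙ F 20))
      ≈⟨ *-congˡ {F 1 ∙ F 4} (*-comm (evenPart ⊕ q^ 1 ∙ oddPart) (F 4 ∙ F 20)) ⟩
    (F 1 ∙ F 4) ∙ ((F 4 ∙ F 20) ∙ (evenPart ⊕ q^ 1 ∙ oddPart))
      ≈⟨ *-assoc (F 1 ∙ F 4) (F 4 ∙ F 20) (evenPart ⊕ q^ 1 ∙ oddPart) ⟨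
    ((F 1 ∙ F 4) ∙ (F 4 ∙ F 20)) ∙ (evenPart ⊕ q^ 1 ∙ oddPart) ∎)
  where
  open ≈-Reasoning
  F : ℕ → Series
  F j = ⟨ j ⨾ j ⟩⁻

-- Positivity

NonNegative : Series → Set
NonNegative u = ∀ n → 0ℤ ≤ u n

SupportedOn : ℕ → Series → Set
SupportedOn d u = ∀ {n} → d ∤ n → u n ≡ 0ℤ

*-nonNegative : ∀ {i j} → 0ℤ ≤ i → 0ℤ ≤ j → 0ℤ ≤ i * j
*-nonNegative {+ m} {+ n} _ _ = subst (0ℤ ≤_) (ℤ.pos-* m n) (+≤+ z≤n)

*-positive : ∀ {i j} → 0ℤ < i → 0ℤ < j → 0ℤ < i * j
*-positive {+ suc m} {+ suc n} _ _ = +<+ (s≤s z≤n)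
*-positive {+ zero} (+<+ ())
*-positive {+ suc m} {+ zero} _ (+<+ ())

∙-nonNegative : ∀ {u v} → NonNegative u → NonNegative v → NonNegative (u ∙ v)
∙-nonNegative {u} {v} p q zero    = subst (0ℤ ≤_) (sym (∙-at-0 u v)) (*-nonNegative (p 0) (q 0))
∙-nonNegative {u} {v} p q (suc n) = subst (0ℤ ≤_) (sym (∙-at-suc u v n))
  (ℤ.+-mono-≤ (*-nonNegative (p 0) (q (suc n))) (∙-nonNegative {tail u} (p ∘ suc) q n))

∙-positive : ∀ {u v} i j → NonNegative u → NonNegative v → 0ℤ < u i → 0ℤ < v j → 0ℤ < (u ∙ v) (i ℕ.+ j)
∙-positive {u} {v} zero    zero    p q x y = subst (0ℤ <_) (sym (∙-at-0 u v)) (*-positive x y)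
∙-positive {u} {v} zero    (suc j) p q x y = subst (0ℤ <_) (sym (∙-at-suc u v j))
  (ℤ.+-mono-<-≤ (*-positive x y) (∙-nonNegative {tail u} (p ∘ suc) q j))
∙-positive {u} {v} (suc i) j       p q x y = subst (0ℤ <_) (sym (∙-at-suc u v (i ℕ.+ j)))
  (ℤ.+-mono-≤-< (*-nonNegative (p 0) (q (suc (i ℕ.+ j)))) (∙-positive {tail u} i j (p ∘ suc) q x y))

∙-vanishes : ∀ {u v} n → (∀ i j → i ℕ.+ j ≡ n → u i * v j ≡ 0ℤ) → (u ∙ v) n ≡ 0ℤ
∙-vanishes {u} {v} zero    p = trans (∙-at-0 u v) (p 0 0 refl)
∙-vanishes {u} {v} (suc n) p = trans (∙-at-suc u v n)
  (cong₂ _+_ (p 0 (suc n) refl) (∙-vanishes {tail u} n λ i j i+j≡n → p (suc i) j (cong suc i+j≡n)))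

∙-supported : ∀ {d u v} → SupportedOn d u → SupportedOn d v → SupportedOn d (u ∙ v)
∙-supported {d} {u} {v} p q {n} d∤n = ∙-vanishes n go
  where
  go : ∀ i j → i ℕ.+ j ≡ n → u i * v j ≡ 0ℤ
  go i j refl with d ∣? i
  ... | no  d∤i = cong (_* v j) (p d∤i)
  ... | yes d∣i = trans (cong (u i *_) (q λ d∣j → d∤n (∣m∣n⇒∣m+n d∣i d∣j))) (ℤ.*-zeroʳ (u i))

-- The two properties are bundled because both pass to products and hold for 1 + q^e and 1 / (1 -
-- q^e) whenever d divides e.
record Admissible (d : ℕ) (u : Series) : Set where
  field
    nonNegative : NonNegative u
    supported   : SupportedOn d u
open Admissible

infixr 7 _∙ᵃ_
_∙ᵃ_ : ∀ {d u v} → Admissible d u → Admissible d v → Admissible d (u ∙ v)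
p ∙ᵃ q = record
  { nonNegative = ∙-nonNegative (nonNegative p) (nonNegative q)
  ; supported   = ∙-supported (supported p) (supported q) }

q^-admissible : ∀ {d} e → d ∣ e → Admissible d (q^ e)
q^-admissible {d} e d∣e = record
  { nonNegative = λ n → indicator≥0 (does (n ℕ.≟ e))
  ; supported   = λ {n} d∤n → q^-≢ e n λ { refl → d∤n d∣e } }
  where
  indicator≥0 : ∀ b → 0ℤ ≤ (if b then 1ℤ else 0ℤ)
  indicator≥0 true  = +≤+ z≤n
  indicator≥0 false = +≤+ z≤n

partial-admissible : ∀ {d g} → (∀ k → Admissible d (g k)) → ∀ N → Admissible d (partial g N)
partial-admissible {d} p zero    = q^-admissible 0 (divides 0 refl)
partial-admissible     p (suc N) = p N ∙ᵃ partial-admissible p N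

progression-admissible : ∀ {d φ} → (∀ e → d ∣ e → Admissible d (φ e)) → ∀ c a → d ∣ c → d ∣ a → Admissible d (progression φ c a)
progression-admissible {d} {φ} p c a d∣c d∣a = record
  { nonNegative = λ n → nonNegative (partials n) n
  ; supported   = λ {n} → supported (partials n) }
  where
  partials : ∀ N → Admissible d (partial (λ k → φ (a ℕ.+ k ℕ.* c)) N)
  partials = partial-admissible λ k → p (a ℕ.+ k ℕ.* c) (∣m∣n⇒∣m+n d∣a (∣n⇒∣m*n k d∣c))

φ⁺-admissible : ∀ {d} e → d ∣ e → Admissible d (φ⁺ e)
φ⁺-admissible {d} e d∣e = record
  { nonNegative = λ n → ℤ.+-mono-≤ (nonNegative one n) (nonNegative (q^-admissible e d∣e) n)
  ; supported   = λ d∤n → cong₂ _+_ (supported one d∤n) (supported (q^-admissible e d∣e) d∤n) }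
  where
  one : Admissible d 𝟙
  one = q^-admissible 0 (divides 0 refl)

geometric-admissible : ∀ {d} e → d ∣ e → Admissible d (geometric e)
geometric-admissible {d} e d∣e = record { nonNegative = nonNeg ; supported = supp }
  where
  nonNeg : NonNegative (geometric e)
  nonNeg n with e ∣? n
  ... | yes _ = +≤+ z≤n
  ... | no  _ = +≤+ z≤n
  supp : SupportedOn d (geometric e)
  supp {n} d∤n with e ∣? n
  ... | yes e∣n with () ← d∤n (∣-trans d∣e e∣n)
  ... | no  _   = refl

∙ᵃ-positive : ∀ {d u v} i j → Admissible d u → Admissible d v → 0ℤ < u i → 0ℤ < v j → 0ℤ < (u ∙ v) (i ℕ.+ j)
∙ᵃ-positive i j p q = ∙-positive i j (nonNegative p) (nonNegative q)

0<1 : 0ℤ < 1ℤ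
0<1 = +<+ (s≤s z≤n)

1⇒positive : ∀ {i} → i ≡ 1ℤ → 0ℤ < i
1⇒positive i≡1 = subst (0ℤ <_) (sym i≡1) 0<1

-- The remaining factors are nonnegative with constant term 1, so nothing can cancel the
-- contribution of the front factor.
Π-positive : ∀ {d g} → Convergent g → (∀ k → Admissible d (g k)) → ∀ n → 0ℤ < g 0 n → 0ℤ < Π g n
Π-positive     conv p zero    _ = 0<1
Π-positive {g = g} conv p (suc n) x = subst (0ℤ <_) (sym (coeff (partial-front g n) (suc n)))
  (subst (λ m → 0ℤ < (g 0 ∙ partial (g ∘ suc) n) m) (ℕ.+-identityʳ (suc n))
    (∙ᵃ-positive (suc n) 0 (p 0) (partial-admissible (p ∘ suc) n) x (1⇒positive (constants n))))
  where
  constants : ∀ N → partial (g ∘ suc) N 0 ≡ 1ℤ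
  constants zero    = refl
  constants (suc N) = ∙-constant {g (suc N)} (coeff< (conv (suc N)) (s≤s z≤n)) (constants N)

-- The divisor d is left open: 4 serves `evenPart`, 2 serves `oddPart`, and 1 suffices where only
-- signs matter.
W-factor-admissible : ∀ {d} a → d ∣ 4 → 4 ∣ a → Admissible d (progression geometric 20 a)
W-factor-admissible a d∣4 4∣a = progression-admissible geometric-admissible 20 a (∣-trans d∣4 (divides 5 refl)) (∣-trans d∣4 4∣a)

W-tail-admissible : ∀ {d} → d ∣ 4 → Admissible d W-tail
W-tail-admissible d∣4 =
  W-factor-admissible 8 d∣4 (divides 2 refl) ∙ᵃ W-factor-admissible 12 d∣4 (divides 3 refl) ∙ᵃ W-factor-admissible 16 d∣4 (divides 4 refl)

W-admissible : ∀ {d} → d ∣ 4 → Admissible d W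
W-admissible d∣4 = W-factor-admissible 4 d∣4 ∣-refl ∙ᵃ W-tail-admissible d∣4

W-positive : ∀ n → 0ℤ < W (4 ℕ.* n)
W-positive n = subst (λ m → 0ℤ < W m) (ℕ.+-identityʳ (4 ℕ.* n))
  (∙ᵃ-positive (4 ℕ.* n) 0 (W-factor-admissible 4 (1∣ 4) ∣-refl) (W-tail-admissible (1∣ 4))
    (Π-positive (progression-convergent geometric 20 4) (λ k → geometric-admissible (4 ℕ.+ k ℕ.* 20) (1∣ _)) (4 ℕ.* n)
      (1⇒positive (geometric-∣ {4} (m∣m*n n))))
    (1⇒positive (∙-constant {progression geometric 20 8} {progression geometric 20 12 ∙ progression geometric 20 16} refl
      (∙-constant {progression geometric 20 12} {progression geometric 20 16} refl refl))))

evenNumerator-admissible : Admissible 4 evenNumerator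
evenNumerator-admissible = (factor 16 (divides 4 refl) ∙ᵃ factor 4 ∣-refl) ∙ᵃ (factor 12 (divides 3 refl) ∙ᵃ factor 8 (divides 2 refl))
  where
  factor : ∀ a → 4 ∣ a → Admissible 4 ⟨ a ⨾ 20 ⟩⁺
  factor a = progression-admissible φ⁺-admissible 20 a (divides 5 refl)

evenNumerator-constant : evenNumerator 0 ≡ 1ℤ
evenNumerator-constant = ∙-constant {⟨ 16 ⨾ 20 ⟩⁺ ∙ ⟨ 4 ⨾ 20 ⟩⁺} {⟨ 12 ⨾ 20 ⟩⁺ ∙ ⟨ 8 ⨾ 20 ⟩⁺}
  (∙-constant {⟨ 16 ⨾ 20 ⟩⁺} {⟨ 4 ⨾ 20 ⟩⁺} refl refl) (∙-constant {⟨ 12 ⨾ 20 ⟩⁺} {⟨ 8 ⨾ 20 ⟩⁺} refl refl)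

oddFactor-admissible : ∀ a → 2 ∣ a → Admissible 2 ⟨ a ⨾ 20 ⟩⁺
oddFactor-admissible a = progression-admissible φ⁺-admissible 20 a (divides 10 refl)

oddNumerator-admissible : Admissible 2 oddNumerator
oddNumerator-admissible = (oddFactor-admissible 6 (divides 3 refl) ∙ᵃ oddFactor-admissible 14 (divides 7 refl)) ∙ᵃ
                          (oddFactor-admissible 2 ∣-refl ∙ᵃ oddFactor-admissible 18 (divides 9 refl))

oddNumerator-positive : ∀ i → 0ℤ < ⟨ 2 ⨾ 20 ⟩⁺ i → 0ℤ < oddNumerator i
oddNumerator-positive i x = subst (λ m → 0ℤ < oddNumerator m) (ℕ.+-identityʳ i)
  (∙ᵃ-positive 0 (i ℕ.+ 0)
    (oddFactor-admissible 6 (divides 3 refl) ∙ᵃ oddFactor-admissible 14 (divides 7 refl))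
    (oddFactor-admissible 2 ∣-refl ∙ᵃ oddFactor-admissible 18 (divides 9 refl))
    (1⇒positive (∙-constant {⟨ 6 ⨾ 20 ⟩⁺} {⟨ 14 ⨾ 20 ⟩⁺} refl refl))
    (∙ᵃ-positive i 0 (oddFactor-admissible 2 ∣-refl) (oddFactor-admissible 18 (divides 9 refl)) x 0<1))

evenPart-admissible : Admissible 4 evenPart
evenPart-admissible = evenNumerator-admissible ∙ᵃ W-admissible ∣-refl

oddPart-admissible : Admissible 2 oddPart
oddPart-admissible = oddNumerator-admissible ∙ᵃ W-admissible (divides 2 refl)

evenPart-positive : ∀ n → 0ℤ < evenPart (4 ℕ.* n)
evenPart-positive n = ∙ᵃ-positive 0 (4 ℕ.* n) evenNumerator-admissible (W-admissible ∣-refl)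
  (1⇒positive evenNumerator-constant) (W-positive n)

halve : ∀ n → (∃ λ k → n ≡ 2 ℕ.* k) ⊎ (∃ λ k → n ≡ suc (2 ℕ.* k))
halve zero    = inj₁ (0 , refl)
halve (suc n) with halve n
... | inj₁ (k , refl) = inj₂ (k , refl)
... | inj₂ (k , refl) = inj₁ (suc k , cong suc (sym (ℕ.+-suc k (k ℕ.+ 0))))

oddPart-positive : ∀ n → 0ℤ < oddPart (2 ℕ.* n)
oddPart-positive n with halve n
... | inj₁ (k , refl) = subst (λ m → 0ℤ < oddPart m) (quadruple k)
  (∙ᵃ-positive 0 (4 ℕ.* k) oddNumerator-admissible (W-admissible (divides 2 refl)) (oddNumerator-positive 0 0<1) (W-positive k))
  where
  quadruple : ∀ k → 4 ℕ.* k ≡ 2 ℕ.* (2 ℕ.* k)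
  quadruple = ℕSolver.solve-∀
... | inj₂ (k , refl) = subst (λ m → 0ℤ < oddPart m) (quadruple k)
  -- The 2 is the exponent in 1 + q², the leading factor of `⟨ 2 ⨾ 20 ⟩⁺`.
  (∙ᵃ-positive 2 (4 ℕ.* k) oddNumerator-admissible (W-admissible (divides 2 refl))
    (oddNumerator-positive 2 (Π-positive (progression-convergent φ⁺ 20 2) (λ k → φ⁺-admissible (2 ℕ.+ k ℕ.* 20) (1∣ _)) 2 0<1))
    (W-positive k))
  where
  quadruple : ∀ k → 2 ℕ.+ 4 ℕ.* k ≡ 2 ℕ.* suc (2 ℕ.* k)
  quadruple = ℕSolver.solve-∀

shift-odd-supported : ∀ {u} → SupportedOn 2 u → ∀ {n} → 2 ∣ n → (q^ 1 ∙ u) n ≡ 0ℤ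
shift-odd-supported {u} p {zero}  _     = shift-0 0 u
shift-odd-supported {u} p {suc n} 2∣1+n = trans (shift-+ 1 u n) (p 2∤n)
  where
  2∤n : 2 ∤ n
  2∤n 2∣n = from-no (2 ∣? 1) (∣m+n∣m⇒∣n (subst (2 ∣_) (ℕ.+-comm 1 n) 2∣1+n) 2∣n)

∤-remainder : ∀ d m r → d ∣ m → d ∤ r → d ∤ m ℕ.+ r
∤-remainder d m r d∣m d∤r d∣m+r = d∤r (∣m+n∣m⇒∣n d∣m+r d∣m)

theorem4p3 : ∀ (n : ℕ) → (0ℤ < a (4 ℕ.* n)) × (0ℤ < a (2 ℕ.* n ℕ.+ 1)) × (a (4 ℕ.* n ℕ.+ 2) ≡ 0ℤ)
theorem4p3 n =
    subst (0ℤ <_) (sym (trans (at (4 ℕ.* n)) (trans (cong (λ x → evenPart (4 ℕ.* n) + x) (oddTerm≡0 2∣4n)) (ℤ.+-identityʳ _))))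
      (evenPart-positive n)
  , subst (0ℤ <_) (sym (trans (at (2 ℕ.* n ℕ.+ 1)) (trans (cong₂ _+_ (supported evenPart-admissible 4∤2n+1) oddTerm) (ℤ.+-identityˡ _))))
      (oddPart-positive n)
  -- 4n + 2 is no multiple of 4, so the even part misses it; being even, it is also missed by q
  -- times a series in q².
  , trans (at (4 ℕ.* n ℕ.+ 2)) (cong₂ _+_ (supported evenPart-admissible (∤-remainder 4 (4 ℕ.* n) 2 (m∣m*n n) (from-no (4 ∣? 2))))
      (oddTerm≡0 (∣m∣n⇒∣m+n 2∣4n ∣-refl)))
  where
  at : ∀ m → a m ≡ evenPart m + (q^ 1 ∙ oddPart) m
  at = coeff a-dissection

  2∣4n : 2 ∣ 4 ℕ.* n
  2∣4n = ∣-trans (divides 2 refl) (m∣m*n n)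

  4∤2n+1 : 4 ∤ 2 ℕ.* n ℕ.+ 1
  4∤2n+1 4∣2n+1 = ∤-remainder 2 (2 ℕ.* n) 1 (m∣m*n n) (from-no (2 ∣? 1)) (∣-trans (divides 2 refl) 4∣2n+1)

  oddTerm≡0 : ∀ {m} → 2 ∣ m → (q^ 1 ∙ oddPart) m ≡ 0ℤ
  oddTerm≡0 = shift-odd-supported (supported oddPart-admissible)

  oddTerm : (q^ 1 ∙ oddPart) (2 ℕ.* n ℕ.+ 1) ≡ oddPart (2 ℕ.* n)
  oddTerm = trans (cong (q^ 1 ∙ oddPart) (ℕ.+-comm (2 ℕ.* n) 1)) (shift-+ 1 oddPart (2 ℕ.* n))
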